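{- Let $G$ be a bridgeless graph with $diam(G)=3$. Then $rc(G)\leq 9$.
   Context: All graphs are finite, simple and undirected. $diam(G)=\max_{x,y\in V(G)} d(x,y)$, where $d(x,y)$ is the length of a shortest path between $x$ and $y$. A graph is bridgeless if it has no edge whose removal disconnects it. In an edge-colored graph (adjacent edges may share a color), a path is rainbow if no two of its edges have the same color. The rainbow connection number $rc(G)$ of a connected graph $G$ is the smallest $k$ for which there is an edge-coloring of $G$ with $k$ colors such that every pair of distinct vertices is joined by a rainbow path. -}

module Defs where

open import Level using (0ℓ)
open import Data.Nat using (ℕ; suc; _≤_; _<_)
open import Data.Fin using (Fin)
open import Data.List using (List; []; _∷_; length)
open import Data.List.Relation.Unary.Unique.Propositional using (Unique)
open import Data.List.Relation.Unary.AllPairs using (AllPairs)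
open import Data.Product using (Σ; ∃; _×_; _,_)
open import Data.Empty using (⊥)
open import Data.Sum using (_⊎_; inj₁; inj₂)
open import Relation.Nullary using (¬_)
open import Relation.Binary.PropositionalEquality using (_≡_; _≢_)

record Graph (n : ℕ) : Set₁ where
  field
    Adj    : Fin n → Fin n → Set
    irrefl : ∀ {x} → ¬ Adj x x
    sym    : ∀ {x y} → Adj x y → Adj y x
open Graph public

data WalkFromTo {n : ℕ} (G : Graph n) : Fin n → Fin n → List (Fin n) → Set where
  single : ∀ x → WalkFromTo G x x (x ∷ [])
  step   : ∀ {x y z vs} → Adj G x y → WalkFromTo G y z (y ∷ vs)
         → WalkFromTo G x z (x ∷ y ∷ vs)

edgeCount : {A : Set} → List A → ℕ
edgeCount []       = 0
edgeCount (_ ∷ []) = 0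
edgeCount (_ ∷ v ∷ vs) = suc (edgeCount (v ∷ vs))

record Path {n : ℕ} (G : Graph n) (x y : Fin n) : Set where
  constructor path
  field
    verts  : List (Fin n)
    walk   : WalkFromTo G x y verts
    unique : Unique verts
open Path public

len : ∀ {n} {G : Graph n} {x y} → Path G x y → ℕ
len p = edgeCount (verts p)

Connected : ∀ {n} → Graph n → Set
Connected {n} G = ∀ (x y : Fin n) → Path G x y

DistLe : ∀ {n} → Graph n → Fin n → Fin n → ℕ → Set
DistLe G x y k = Σ (Path G x y) λ p → len p ≤ k

HasDiam : ∀ {n} → Graph n → ℕ → Set
HasDiam {n} G k =
  (∀ (x y : Fin n) → DistLe G x y k)
  × Σ (Fin n) λ x → Σ (Fin n) λ y → ∀ (p : Path G x y) → ¬ (len p < k)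

SameEdge : ∀ {n} → Fin n → Fin n → Fin n → Fin n → Set
SameEdge x y u v = (x ≡ u × y ≡ v) ⊎ (x ≡ v × y ≡ u)

SameEdge-sym : ∀ {n} {x y u v : Fin n} → SameEdge x y u v → SameEdge y x u v
SameEdge-sym (inj₁ (p , q)) = inj₂ (q , p)
SameEdge-sym (inj₂ (p , q)) = inj₁ (q , p)

deleteEdge : ∀ {n} → Graph n → Fin n → Fin n → Graph n
deleteEdge G u v = record
  { Adj    = λ x y → Adj G x y × ¬ SameEdge x y u v
  ; irrefl = λ (a , _) → irrefl G a
  ; sym    = λ { (a , h) → sym G a , λ e → h (SameEdge-sym e) }
  }

-- Bridgeless: G is connected, and removing any single edge leaves it connected.
-- (Connectedness is part of the setting since diam(G) is finite.)
Bridgeless : ∀ {n} → Graph n → Set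
Bridgeless {n} G = ∀ (u v : Fin n) → Adj G u v → Connected (deleteEdge G u v)

record EdgeColoring {n : ℕ} (G : Graph n) (k : ℕ) : Set where
  field
    col     : ∀ {x y} → Adj G x y → Fin k
    col-sym : ∀ {x y} (a : Adj G x y) → col (sym G a) ≡ col a
open EdgeColoring public

walkColors : ∀ {n} {G : Graph n} {k} → EdgeColoring G k
           → ∀ {x y vs} → WalkFromTo G x y vs → List (Fin k)
walkColors c (single _) = []
walkColors c (step a w) = col c a ∷ walkColors c w

Rainbow : ∀ {n} {G : Graph n} {k} → EdgeColoring G k → ∀ {x y} → Path G x y → Set
Rainbow c p = Unique (walkColors c (walk p))

RainbowConnected : ∀ {n} {G : Graph n} {k} → EdgeColoring G k → Set
RainbowConnected {n} {G} c =
  ∀ (x y : Fin n) → x ≢ y → Σ (Path G x y) λ p → Rainbow c p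

RcLe : ∀ {n} → Graph n → ℕ → Set
RcLe G k = Σ (EdgeColoring G k) λ c → RainbowConnected c

{-# OPTIONS --safe #-}

-- If every edge lies in a triangle, take the distance layers around any vertex and spend three colours on each
-- layer: two on the edges going down and one inside the layer, so that any two vertices of a layer can descend
-- in disjoint colours.
--
-- Otherwise let uv be an edge in no triangle. Besides the colour γ of uv there are four colours for the side of u
-- and four for the side of v. Every vertex gets a few rainbow routes to u or v whose colours are confined to
-- prescribed sets, chosen so that any two vertices x, y have routes x → u, y → v (joined by uv), or routes to
-- the same end, in disjoint colours. The decisive case is a vertex x at distance 3 from v: a path of
-- length at most 3 from x to a neighbour b ≠ u of v avoids u, which is how x reaches v without uv.
module Submission where

-- The count nine has two origins: three layers with three colours each, and two sides with four
-- colours each plus the colour of uv. The obstacle is the same in both cases, a pair of vertices of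
-- the same type. To serve such pairs, every vertex except the root or the ends of uv gets two
-- routes in disjoint colours. A vertex with a single useful edge has only one way to begin, so it
-- borrows its second route from a neighbour of its own type, and this works only if their useful
-- edges differ in colour. `Selection` settles which edges take the exceptional colour: among the
-- vertices without alternative, those keeping the ordinary colour form an independent set all of
-- whose neighbours are `High`, and by maximality each `High` vertex has a neighbour that is not. A
-- vertex of the independent set has a neighbour of its type because of a triangle in the first
-- case, and in the second because of minimum degree 2, supplied by bridgelessness. Routes may
-- repeat vertices: repetitions can be cut out, so only colours matter and compatibility of routes
-- is a finite computation on colour lists.

open import Defs
open import Data.Bool using (Bool; true; false; if_then_else_)
open import Data.Empty using (⊥; ⊥-elim)
open import Data.Fin using (Fin; zero; suc; _≟_; toℕ; combine; #_)
open import Data.Fin.Patterns using (0F; 1F; 2F; 3F; 4F; 5F; 6F; 7F; 8F)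
open import Data.Fin.Properties using (any?; all?)
open import Data.List using (List; []; _∷_; _++_; reverse; allFin)
open import Data.List.Membership.DecPropositional using (_∈?_)
open import Data.List.Membership.Propositional using (_∈_; _∉_)
open import Data.List.Membership.Propositional.Properties using (∈-++⁺ˡ; ∈-++⁺ʳ; ∈-++⁻; ∈-allFin)
open import Data.List.Properties using (unfold-reverse)
open import Data.List.Relation.Binary.Disjoint.DecPropositional using (disjoint?)
open import Data.List.Relation.Binary.Disjoint.Propositional using (Disjoint)
open import Data.List.Relation.Binary.Permutation.Propositional using (↭-sym; ↭⇒↭ₛ)
open import Data.List.Relation.Binary.Permutation.Propositional.Properties using (↭-reverse; ∈-resp-↭)
open import Data.List.Relation.Binary.Permutation.Setoid.Properties using (Unique-resp-↭)
open import Data.List.Relation.Binary.Subset.DecPropositional using (_⊆?_)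
open import Data.List.Relation.Binary.Subset.Propositional using (_⊆_)
open import Data.List.Relation.Unary.All as All using (All; []; _∷_)
open import Data.List.Relation.Unary.All.Properties using (¬Any⇒All¬; All¬⇒¬Any)
open import Data.List.Relation.Unary.AllPairs using ([]; _∷_)
open import Data.List.Relation.Unary.Any as Any using (Any; here; there)
open import Data.List.Relation.Unary.Unique.DecPropositional using (unique?)
open import Data.List.Relation.Unary.Unique.Propositional using (Unique)
import Data.List.Relation.Unary.Unique.Propositional.Properties as Unique
open import Data.Maybe using (Maybe; just; nothing)
open import Data.Maybe.Properties as Maybe using (just-injective)
open import Data.Nat as ℕ using (ℕ; zero; suc; _≤_; _<_; z≤n; s≤s; _⊔_; pred)
open import Data.Nat.Properties as ℕ using (≤-refl; ≤-antisym; ⊔-comm; m≥n⇒m⊔n≡m; n≤1+n; ⊔-idem; 1+n≢n; ≤-reflexive)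
open import Data.Product using (Σ; ∃; ∃₂; _×_; _,_; proj₁; proj₂)
open import Data.Product.Properties using (≡-dec)
open import Data.Sum using (_⊎_; inj₁; inj₂; [_,_]′; swap)
open import Data.Unit using (⊤; tt)
open import Function using (_∘_; id; case_of_)
open import Relation.Binary.PropositionalEquality using (_≡_; _≢_; refl; trans; cong; cong₂; subst) renaming (sym to ≡-sym)
import Relation.Binary.PropositionalEquality.Properties as ≡
open import Relation.Nullary using (¬_; Dec; yes; no; does; contradiction)
open import Relation.Nullary.Decidable using (True; toWitness; from-yes; map′; decidable-stable; dec-true; dec-false; ¬?; _×-dec_; _⊎-dec_; _→-dec_)

-- Adj need not be decidable, so the argument runs on the subgraph H of the edges occurring in the walks provided
-- by the hypotheses; extra edges of G only help.
record FinGraph (n : ℕ) : Set₁ where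
  field
    E        : Fin n → Fin n → Set
    E?       : ∀ x y → Dec (E x y)
    E-sym    : ∀ {x y} → E x y → E y x
    E-irrefl : ∀ {x} → ¬ E x x

  infix 4 _⁼_
  _⁼_ : Fin n → Fin n → Set
  x ⁼ y = x ≡ y ⊎ E x y

  Near3 : Fin n → Fin n → Set
  Near3 x y = ∃₂ λ a b → x ⁼ a × a ⁼ b × b ⁼ y

record Diam3MinDeg2 {n : ℕ} (H : FinGraph n) : Set where
  open FinGraph H
  field
    diam : ∀ x y → Near3 x y
    deg  : ∀ x y → ∃ λ z → E x z × z ≢ y

-- Rainbow trails with prescribed colour sets

Colour : Set
Colour = Fin 9

Fits : List Colour → List Colour → List Colour → Set
Fits S T U = Disjoint S T × S ⊆ U × T ⊆ U

fits? : ∀ S T U → Dec (Fits S T U)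
fits? S T U = disjoint? _≟_ S T ×-dec _⊆?_ _≟_ S U ×-dec _⊆?_ _≟_ T U

module Routes {n : ℕ} (H : FinGraph n) (c : Fin n → Fin n → Colour)
              (c-sym : ∀ x y → c x y ≡ c y x) where
  open FinGraph H

  data Trail : Fin n → Fin n → List Colour → Set where
    []     : ∀ {x} → Trail x x []
    _by_⇢_ : ∀ {x y z k ks} → E x y → c x y ≡ k → Trail y z ks → Trail x z (k ∷ ks)

  infixr 5 _by_⇢_

  _++ᵗ_ : ∀ {x y z ks ls} → Trail x y ks → Trail y z ls → Trail x z (ks ++ ls)
  []            ++ᵗ q = q
  (e by eq ⇢ p) ++ᵗ q = e by eq ⇢ (p ++ᵗ q)

  reverseᵗ : ∀ {x y ks} → Trail x y ks → Trail y x (reverse ks)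
  reverseᵗ [] = []
  reverseᵗ {x} (_by_⇢_ {y = y} {k = k} {ks = ks} e eq p) =
    subst (Trail _ _) (≡-sym (unfold-reverse k ks))
      (reverseᵗ p ++ᵗ (E-sym e by trans (c-sym y x) eq ⇢ []))

  record Route (x y : Fin n) (S : List Colour) : Set where
    constructor route
    field
      {colours} : List Colour
      trail     : Trail x y colours
      unique    : Unique colours
      within    : colours ⊆ S

  stay : ∀ {x S} → Route x x S
  stay = route [] [] λ ()

  join : ∀ {x y z S T U} → Fits S T U → Route x y S → Route y z T → Route x z U
  join (dis , S⊆U , T⊆U) (route p u p⊆S) (route q v q⊆T) =
    route (p ++ᵗ q) (Unique.++⁺ u v λ (k∈p , k∈q) → dis (p⊆S k∈p , q⊆T k∈q))
          ([ S⊆U ∘ p⊆S , T⊆U ∘ q⊆T ]′ ∘ ∈-++⁻ _)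

  -- The colour conditions are decided by evaluation, which needs closed lists. Quantifying over the
  -- finite index lets one computation serve a side or layer that is still a variable.
  link : ∀ {m} (S T U : Fin m → List Colour) {_ : True (all? λ i → fits? (S i) (T i) (U i))}
       → ∀ i {x y z} → Route x y (S i) → Route y z (T i) → Route x z (U i)
  link S T U {ok} i = join (toWitness ok i)

  along : ∀ {m} (ks : Fin m → List Colour) {_ : True (all? λ i → unique? _≟_ (ks i))}
        → ∀ i {x y} → Trail x y (ks i) → Route x y (ks i)
  along ks {ok} i p = route p (toWitness ok i) id

  via : ∀ {m} (ks S T : Fin m → List Colour) {_ : True (all? λ i → unique? _≟_ (ks i))}
        {_ : True (all? λ i → fits? (ks i) (S i) (T i))}
      → ∀ i {x y z} → Trail x y (ks i) → Route y z (S i) → Route x z (T i)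
  via ks S T {u} {ok} i p = link ks S T {ok} i (along ks {u} i p)

  reverseʳ : ∀ {x y S} → Route x y S → Route y x S
  reverseʳ (route {ks} p u p⊆S) =
    route (reverseᵗ p) (Unique-resp-↭ (≡.setoid _) (↭⇒↭ₛ (↭-sym (↭-reverse ks))) u)
          (p⊆S ∘ ∈-resp-↭ (↭-reverse ks))

  RainbowConn : Set
  RainbowConn = ∀ x y → ∃ (Route x y)

-- From rainbow trails to rainbow paths

module Shortcut {n : ℕ} (G : Graph n) (H : FinGraph n) (c : Fin n → Fin n → Colour)
                (c-sym : ∀ x y → c x y ≡ c y x)
                (H⊆G : ∀ {x y} → FinGraph.E H x y → Adj G x y) where
  open FinGraph H
  open Routes H c c-sym

  colouring : EdgeColoring G 9
  colouring = record { col = λ {x} {y} _ → c x y ; col-sym = λ {x} {y} _ → c-sym y x }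

  record Shortened (x y : Fin n) (ks : List Colour) : Set where
    constructor shortened
    field
      short : Path G x y
      rainb : Rainbow colouring short
      fewer : walkColors colouring (walk short) ⊆ ks

  cutAt : ∀ {x y z ks vs} (w : WalkFromTo G y z vs) → Unique vs → x ∈ vs
        → Unique (walkColors colouring w) → walkColors colouring w ⊆ ks → Shortened x z ks
  cutAt w@(single _) u (here refl) r sub = shortened (path _ w u) r sub
  cutAt w@(step _ _) u (here refl) r sub = shortened (path _ w u) r sub
  cutAt (step a w) (_ ∷ u) (there m) (_ ∷ r) sub = cutAt w u m r (sub ∘ there)

  start : ∀ {y z vs} → WalkFromTo G y z vs → ∃ λ vs′ → vs ≡ y ∷ vs′
  start (single _) = _ , refl
  start (step _ _) = _ , refl

  -- If the new first vertex already occurs on the shortened rest, everything before that occurrence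
  -- is dropped. This only loses colours, and `fewer` records it so that the next prepended colour
  -- is still fresh.
  shorten : ∀ {x y ks} → Trail x y ks → Unique ks → Shortened x y ks
  shorten [] _ = shortened (path _ (single _) ([] ∷ [])) [] λ ()
  shorten {x} {ks = k ∷ ks} (e by refl ⇢ p) (k∉ks ∷ u) with shorten p u
  ... | shortened (path vs w uvs) r sub with start w
  ...   | _ , refl with _∈?_ _≟_ x vs
  ...     | yes x∈vs = cutAt w uvs x∈vs r (there ∘ sub)
  ...     | no  x∉vs = shortened (path _ (step (H⊆G e) w) (¬Any⇒All¬ _ x∉vs ∷ uvs))
                         (¬Any⇒All¬ _ (All¬⇒¬Any k∉ks ∘ sub) ∷ r)
                         λ { (here eq) → here eq ; (there m) → there (sub m) }

  rainbow⇒RcLe : RainbowConn → RcLe G 9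
  rainbow⇒RcLe conn = colouring , λ x y _ → connect x y
    where
    connect : ∀ x y → Σ (Path G x y) (Rainbow colouring)
    connect x y with conn x y
    ... | _ , route p u _ with shorten p u
    ...   | shortened q r _ = q , r

-- A decidable subgraph with diameter bound and minimum degree 2

module Extract {n : ℕ} (G : Graph n) (bridgeless : Bridgeless G) (hasDiam : HasDiam G 3) where

  V : Set
  V = Fin n

  edges : ∀ {x y vs} → WalkFromTo G x y vs → List (V × V)
  edges (single _)             = []
  edges (step {x} {y} _ w) = (x , y) ∷ edges w

  edges-adj : ∀ {x y vs a b} (w : WalkFromTo G x y vs) → (a , b) ∈ edges w → Adj G a b
  edges-adj (step a w) (here refl) = a
  edges-adj (step a w) (there m)   = edges-adj w m

  firstStep : ∀ {G′ : Graph n} {x y} → x ≢ y → Path G′ x y → ∃ (Adj G′ x)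
  firstStep x≢y (path _ (single _) _) = contradiction refl x≢y
  firstStep x≢y (path _ (step a _) _) = _ , a

  distinct : ∃₂ λ (x y : V) → x ≢ y
  distinct with proj₂ hasDiam
  ... | x , y , far = x , y , λ { refl → far (path _ (single _) ([] ∷ [])) (s≤s z≤n) }

  neighbour : ∀ x → ∃ (Adj G x)
  neighbour x with distinct
  ... | p , q , p≢q with x ≟ p
  ...   | yes refl = firstStep p≢q (proj₁ (proj₁ hasDiam p q))
  ...   | no  x≢p  = firstStep x≢p (proj₁ (proj₁ hasDiam x p))

  -- Bridgelessness enters here: if the neighbour at hand is `y` itself, a path from `x` to it
  -- avoiding their edge must leave `x` through another vertex.
  neighbour≢ : ∀ x y → ∃ λ z → Adj G x z × z ≢ y
  neighbour≢ x y with neighbour x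
  ... | z , a with z ≟ y
  ...   | no  z≢y  = z , a , z≢y
  ...   | yes refl
    with firstStep (λ { refl → irrefl G a }) (bridgeless x z a x z)
  ...     | z′ , a′ , new = z′ , a′ , λ { refl → new (inj₁ (refl , refl)) }

  used : V → V → List (V × V)
  used x y = (x , proj₁ (neighbour≢ x y)) ∷ edges (walk (proj₁ (proj₁ hasDiam x y)))

  used-adj : ∀ {a b} x y → (a , b) ∈ used x y → Adj G a b
  used-adj x y (here refl) = proj₁ (proj₂ (neighbour≢ x y))
  used-adj x y (there m)   = edges-adj (walk (proj₁ (proj₁ hasDiam x y))) m

  _≟²_ : (p q : V × V) → Dec (p ≡ q)
  _≟²_ = ≡-dec _≟_ _≟_

  Used : V → V → Set
  Used a b = ∃₂ λ x y → (a , b) ∈ used x y ⊎ (b , a) ∈ used x y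

  Used⇒Adj : ∀ {a b} → Used a b → Adj G a b
  Used⇒Adj (x , y , inj₁ m) = used-adj x y m
  Used⇒Adj (x , y , inj₂ m) = sym G (used-adj x y m)

  H : FinGraph n
  H = record
    { E        = Used
    ; E?       = λ a b → any? λ x → any? λ y →
                   _∈?_ _≟²_ (a , b) (used x y) ⊎-dec _∈?_ _≟²_ (b , a) (used x y)
    ; E-sym    = λ (x , y , m) → x , y , swap m
    ; E-irrefl = irrefl G ∘ Used⇒Adj
    }

  open FinGraph H

  walk⇒Near3 : ∀ {x y vs} (w : WalkFromTo G x y vs) → edgeCount vs ≤ 3
             → (∀ {a b} → (a , b) ∈ edges w → E a b) → Near3 x y
  walk⇒Near3 (single _) _ _ = _ , _ , inj₁ refl , inj₁ refl , inj₁ refl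
  walk⇒Near3 (step _ (single _)) _ f = _ , _ , inj₁ refl , inj₁ refl , inj₂ (f (here refl))
  walk⇒Near3 (step _ (step _ (single _))) _ f =
    _ , _ , inj₁ refl , inj₂ (f (here refl)) , inj₂ (f (there (here refl)))
  walk⇒Near3 (step _ (step _ (step _ (single _)))) _ f =
    _ , _ , inj₂ (f (here refl)) , inj₂ (f (there (here refl))) , inj₂ (f (there (there (here refl))))
  walk⇒Near3 (step _ (step _ (step _ (step _ (single _))))) (s≤s (s≤s (s≤s ()))) _
  walk⇒Near3 (step _ (step _ (step _ (step _ (step _ _))))) (s≤s (s≤s (s≤s ()))) _

  bounds : Diam3MinDeg2 H
  bounds = record
    { diam = λ x y → walk⇒Near3 (walk (proj₁ (proj₁ hasDiam x y))) (proj₂ (proj₁ hasDiam x y))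
                       λ m → x , y , inj₁ (there m)
    ; deg  = λ x y → proj₁ (neighbour≢ x y) , (x , y , inj₁ (here refl))
                       , proj₂ (proj₂ (neighbour≢ x y))
    }

-- Choosing edges by a maximal independent set

-- A vertex offered a candidate edge chooses it if it has an alternative. A vertex without alternative chooses it
-- unless it lies in a maximal independent set of the R-graph, so that it has an R-neighbour deciding otherwise
-- (as soon as it has any R-neighbour). High vertices are those that choose without having an alternative.
data Status {V : Set} (R : V → V → Set) (Free : V → Set) (Cand Alt : V → V → Set) (High : V → Set)
            (x : V) : Maybe V → Set where
  free : ¬ High x → Free x → Status R Free Cand Alt High x nothing
  both : ∀ {a} → ¬ High x → Cand x a → Alt x a → Status R Free Cand Alt High x (just a)
  low  : ∀ {a} → ¬ High x → Cand x a → ¬ Alt x a → (∀ y → R x y → High y)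
       → Status R Free Cand Alt High x nothing
  high : ∀ {a} → High x → Cand x a → ¬ Alt x a → (∃ λ y → R x y × ¬ High y)
       → Status R Free Cand Alt High x (just a)

record Selection {V : Set} (R : V → V → Set) (Free : V → Set) (Cand Alt : V → V → Set) : Set₁ where
  field
    sel    : V → Maybe V
    High   : V → Set
    status : ∀ x → Status R Free Cand Alt High x (sel x)

module Labelling {n : ℕ} (R : Fin n → Fin n → Set) (R? : ∀ x y → Dec (R x y))
                 (R-sym : ∀ {x y} → R x y → R y x) (R-irrefl : ∀ {x} → ¬ R x x) where

  V : Set
  V = Fin n

  record Independent (P : V → Set) (xs : List V) : Set where
    field
      set         : List V
      inside      : ∀ {x} → x ∈ set → P x
      independent : ∀ {x y} → x ∈ set → y ∈ set → ¬ R x y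
      maximal     : ∀ {x} → x ∈ xs → P x → x ∈ set ⊎ ∃ λ y → y ∈ set × R x y
  open Independent

  greedy : ∀ {P : V → Set} → (∀ x → Dec (P x)) → ∀ xs → Independent P xs
  greedy P? [] = record { set = [] ; inside = λ () ; independent = λ () ; maximal = λ () }
  greedy P? (x ∷ xs) with greedy P? xs
  ... | I with P? x | any? (λ y → _∈?_ _≟_ y (set I) ×-dec R? x y)
  ...   | no ¬px | _ = record
    { set = set I ; inside = inside I ; independent = independent I
    ; maximal = λ { (here refl) px → contradiction px ¬px ; (there m) → maximal I m } }
  ...   | yes _ | yes dominated = record
    { set = set I ; inside = inside I ; independent = independent I
    ; maximal = λ { (here refl) _ → inj₂ dominated ; (there m) → maximal I m } }
  ...   | yes px | no alone = record
    { set         = x ∷ set I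
    ; inside      = λ { (here refl) → px ; (there m) → inside I m }
    ; independent = λ { (here refl) (here refl) r → R-irrefl r
                      ; (here refl) (there m)   r → alone (_ , m , r)
                      ; (there m)   (here refl) r → alone (_ , m , R-sym r)
                      ; (there m)   (there m′)  r → independent I m m′ r }
    ; maximal     = λ { (here refl) _ → inj₁ (here refl)
                      ; (there m) py → [ inj₁ ∘ there , (λ (z , m′ , r) → inj₂ (z , there m′ , r)) ]′
                                         (maximal I m py) }
    }

  module _ {Free : V → Set} {Cand : V → V → Set} (pick : ∀ x → Free x ⊎ ∃ (Cand x))
                   {Alt : V → V → Set} (Alt? : ∀ x a → Dec (Alt x a)) where

    Poor : V → Set
    Poor x = ∃₂ λ a ca → pick x ≡ inj₂ (a , ca) × ¬ Alt x a

    poor? : ∀ x → Dec (Poor x)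
    poor? x with pick x
    ... | inj₁ _ = no λ ()
    ... | inj₂ (a , ca) with Alt? x a
    ...   | yes alt = no λ { (_ , _ , refl , ¬alt) → ¬alt alt }
    ...   | no ¬alt = yes (a , ca , refl , ¬alt)

    -- A poor vertex with a neighbour that is not poor can be `High` at once, as that neighbour is
    -- not. A genuine decision remains only for poor vertices surrounded by poor ones, so the
    -- independent set is taken among these.
    Secluded : V → Set
    Secluded x = Poor x × ∀ y → R x y → Poor y

    secluded : Independent Secluded (allFin n)
    secluded = greedy (λ x → poor? x ×-dec all? λ y → R? x y →-dec poor? y) (allFin n)

    High : V → Set
    High x = Poor x × x ∉ set secluded

    high? : ∀ x → Dec (High x)
    high? x = poor? x ×-dec ¬? (_∈?_ _≟_ x (set secluded))

    high-escapes : ∀ {x} → High x → ∃ λ y → R x y × ¬ High y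
    high-escapes {x} (px , x∉) with all? (λ y → R? x y →-dec poor? y)
    ... | yes ps with maximal secluded (∈-allFin x) (px , ps)
    ...   | inj₁ x∈           = contradiction x∈ x∉
    ...   | inj₂ (y , y∈ , r) = y , r , λ (_ , y∉) → y∉ y∈
    high-escapes {x} (px , x∉) | no ¬ps with any? (λ y → R? x y ×-dec ¬? (poor? y))
    ...   | yes (y , r , ¬py) = y , r , ¬py ∘ proj₁
    ...   | no none = contradiction (λ y r → decidable-stable (poor? y) λ ¬py → none (y , r , ¬py)) ¬ps

    poor-low : ∀ {x} → Poor x → ¬ High x → ∀ y → R x y → High y
    poor-low {x} px ¬h y r with _∈?_ _≟_ x (set secluded)
    ... | no  x∉ = contradiction (px , x∉) ¬h
    ... | yes x∈ = proj₂ (inside secluded x∈) y r , λ y∈ → independent secluded x∈ y∈ r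

    select : ∀ x → ∃ (Status R Free Cand Alt High x)
    select x with pick x in eq
    ... | inj₁ f = nothing , free (λ { ((_ , _ , eq′ , _) , _) → case trans (≡-sym eq) eq′ of λ () }) f
    ... | inj₂ (a , ca) with Alt? x a
    ...   | yes alt = just a , both ¬h ca alt
      where
      ¬h : ¬ High x
      ¬h ((_ , _ , eq′ , ¬alt) , _) with trans (≡-sym eq) eq′
      ... | refl = ¬alt alt
    ...   | no ¬alt with high? x
    ...     | yes h = just a , high h ca ¬alt (high-escapes h)
    ...     | no ¬h = nothing , low ¬h ca ¬alt (poor-low (a , ca , eq , ¬alt) ¬h)

    selection : Selection R Free Cand Alt
    selection = record { sel = proj₁ ∘ select ; High = High ; status = proj₂ ∘ select }

-- Every edge in a triangle: colouring the distance layers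

module Triangles {n : ℕ} (H : FinGraph n) (near3 : ∀ x y → FinGraph.Near3 H x y)
                 (triangle : ∀ {x y} → FinGraph.E H x y → ∃ λ z → FinGraph.E H x z × FinGraph.E H y z)
                 (root : Fin n) where
  open FinGraph H

  V : Set
  V = Fin n

  Within : ℕ → V → Set
  Within zero    x = x ≡ root
  Within (suc k) x = ∃ λ y → x ⁼ y × Within k y

  within? : ∀ k x → Dec (Within k x)
  within? zero    x = x ≟ root
  within? (suc k) x = any? λ y → (x ≟ y ⊎-dec E? x y) ×-dec within? k y

  Level : V → ℕ → Set
  Level x k = k ≤ 3 × Within k x × ∀ j → Within j x → k ≤ j

  opaque
    level : ∀ x → ∃ (Level x)
    level x with within? 0 x
    ... | yes w = 0 , z≤n , w , λ _ _ → z≤n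
    ... | no ¬0 with within? 1 x
    ...   | yes w = 1 , s≤s z≤n , w , λ { zero v → contradiction v ¬0 ; (suc j) _ → s≤s z≤n }
    ...   | no ¬1 with within? 2 x
    ...     | yes w = 2 , s≤s (s≤s z≤n) , w , λ
      { zero v → contradiction v ¬0 ; (suc zero) v → contradiction v ¬1 ; (suc (suc j)) _ → s≤s (s≤s z≤n) }
    ...     | no ¬2 = 3 , ≤-refl , far , λ
      { zero v → contradiction v ¬0 ; (suc zero) v → contradiction v ¬1
      ; (suc (suc zero)) v → contradiction v ¬2 ; (suc (suc (suc j))) _ → s≤s (s≤s (s≤s z≤n)) }
      where
      far : Within 3 x
      far with near3 x root
      ... | a , b , xa , ab , br = a , xa , b , ab , root , br , refl

  lev : V → ℕ
  lev x = proj₁ (level x)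

  lev≤3 : ∀ x → lev x ≤ 3
  lev≤3 x = proj₁ (proj₂ (level x))

  within-lev : ∀ x → Within (lev x) x
  within-lev x = proj₁ (proj₂ (proj₂ (level x)))

  lev-least : ∀ {x j} → Within j x → lev x ≤ j
  lev-least {x} = proj₂ (proj₂ (proj₂ (level x))) _

  lev-edge : ∀ {x y} → E x y → lev x ≤ suc (lev y)
  lev-edge {y = y} e = lev-least (y , inj₂ e , within-lev y)

  Parent : V → V → Set
  Parent x a = E x a × lev x ≡ suc (lev a)

  parent : ∀ {x j} → lev x ≡ suc j → ∃ (Parent x)
  parent {x} {j} eq with subst (λ k → Within k x) eq (within-lev x)
  ... | y , inj₁ refl , w = contradiction (subst (_≤ j) eq (lev-least w)) (λ p → ℕ.<-irrefl refl p)
  ... | y , inj₂ e    , w =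
    y , e , ≤-antisym (lev-edge e) (subst (suc (lev y) ≤_) (≡-sym eq) (s≤s (lev-least w)))

  pick : ∀ x → lev x ≡ 0 ⊎ ∃ (Parent x)
  pick x with lev x in eq
  ... | zero  = inj₁ refl
  ... | suc j with parent eq
  ...   | a , e , eq′ = inj₂ (a , e , trans (≡-sym eq) eq′)

  Second : V → V → Set
  Second x a = ∃ λ b → Parent x b × b ≢ a

  second? : ∀ x a → Dec (Second x a)
  second? x a = any? λ b → (E? x b ×-dec (lev x ℕ.≟ suc (lev b))) ×-dec ¬? (b ≟ a)

  Peer : V → V → Set
  Peer x y = E x y × lev x ≡ lev y

  opaque
    chosen : Selection Peer (λ x → lev x ≡ 0) Parent Second
    chosen = selection pick second?
      where open Labelling Peer (λ x y → E? x y ×-dec (lev x ℕ.≟ lev y))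
                           (λ (e , eq) → E-sym e , ≡-sym eq) (E-irrefl ∘ proj₁) using (selection)

  open Selection chosen

  sel-parent : ∀ {x a} → sel x ≡ just a → Parent x a
  sel-parent {x} eq with sel x | status x
  sel-parent refl | _ | both _ p _   = p
  sel-parent refl | _ | high _ p _ _ = p

  Selected : V → V → Set
  Selected x y = sel x ≡ just y ⊎ sel y ≡ just x

  selected? : ∀ x y → Dec (Selected x y)
  selected? x y = Maybe.≡-dec _≟_ (sel x) (just y) ⊎-dec Maybe.≡-dec _≟_ (sel y) (just x)

  kind : V → V → Fin 3
  kind x y with lev x ℕ.≟ lev y | selected? x y
  ... | yes _ | _     = 2F
  ... | no  _ | yes _ = 0F
  ... | no  _ | no  _ = 1F

  kind-sym : ∀ x y → kind x y ≡ kind y x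
  kind-sym x y with lev x ℕ.≟ lev y | selected? x y | lev y ℕ.≟ lev x | selected? y x
  ... | yes _  | _     | yes _  | _     = refl
  ... | yes eq | _     | no neq | _     = contradiction (≡-sym eq) neq
  ... | no neq | _     | yes eq | _     = contradiction (≡-sym eq) neq
  ... | no _   | yes _ | no _   | yes _ = refl
  ... | no _   | yes s | no _   | no ¬s = contradiction (swap s) ¬s
  ... | no _   | no ¬s | no _   | yes s = contradiction (swap s) ¬s
  ... | no _   | no _  | no _   | no _  = refl

  -- Layer `j` collects the edges inside level `j + 1` and from it to level `j`. Levels end at 3, so
  -- the last clause only has to separate `j = 2` from the earlier layers.
  layer : ℕ → Fin 3
  layer 0 = 0F
  layer 1 = 1F
  layer _ = 2F

  shade : ℕ → Fin 3 → Colour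
  shade j = combine (layer j)

  opaque
    c : V → V → Colour
    c x y = shade (pred (lev x ⊔ lev y)) (kind x y)

    c-sym : ∀ x y → c x y ≡ c y x
    c-sym x y = cong₂ shade (cong pred (⊔-comm (lev x) (lev y))) (kind-sym x y)

    c-peer : ∀ {x y j} → lev x ≡ suc j → Peer x y → c x y ≡ shade j 2F
    c-peer {x} {y} {j} eq (_ , peer) = cong₂ shade layers kinds
      where
      layers : pred (lev x ⊔ lev y) ≡ j
      layers rewrite ≡-sym peer | eq = ⊔-idem j
      kinds : kind x y ≡ 2F
      kinds with lev x ℕ.≟ lev y | selected? x y
      ... | yes _ | _ = refl
      ... | no ¬p | _ = contradiction peer ¬p

    parent-layer : ∀ {x y j} → lev x ≡ suc j → Parent x y → pred (lev x ⊔ lev y) ≡ j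
    parent-layer {x} {y} eq (_ , p) =
      cong pred (trans (m≥n⇒m⊔n≡m (subst (lev y ≤_) (≡-sym p) (n≤1+n _))) eq)

    parent-lev≢ : ∀ {x y} → Parent x y → lev x ≢ lev y
    parent-lev≢ (_ , p) eq = 1+n≢n (trans (≡-sym p) eq)

    c-sel : ∀ {x y j} → lev x ≡ suc j → sel x ≡ just y → c x y ≡ shade j 0F
    c-sel {x} {y} eq s = cong₂ shade (parent-layer eq (sel-parent s)) kinds
      where
      kinds : kind x y ≡ 0F
      kinds with lev x ℕ.≟ lev y | selected? x y
      ... | yes q | _     = contradiction q (parent-lev≢ (sel-parent s))
      ... | no  _ | yes _ = refl
      ... | no  _ | no ¬s = contradiction (inj₁ s) ¬s

    c-unsel : ∀ {x y j} → lev x ≡ suc j → Parent x y → sel x ≢ just y → c x y ≡ shade j 1F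
    c-unsel {x} {y} eq p ¬s = cong₂ shade (parent-layer eq p) kinds
      where
      kinds : kind x y ≡ 1F
      kinds with lev x ℕ.≟ lev y | selected? x y
      ... | yes q | _             = contradiction q (parent-lev≢ p)
      ... | no  _ | no _          = refl
      ... | no  _ | yes (inj₁ s)  = contradiction s ¬s
      -- If `y` had chosen `x`, each would lie one level above the other, giving
      -- `lev x = 2 + lev x`.
      ... | no  _ | yes (inj₂ s)  = contradiction
        (trans (proj₂ p) (cong suc (proj₂ (sel-parent s)))) (λ q → ℕ.m≢1+n+m _ {1} q)

  open Routes H c c-sym

  Descent : ℕ → V → List Colour → Set
  Descent j x S = ∃ λ y → lev y ≡ j × Route x y S

  -- Two ways down with no colour in common, at most one of which takes the peer colour 2: any two vertices
  -- of the layer can therefore descend simultaneously in disjoint colours.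
  Descents : ℕ → V → Set
  Descents j x =
      Descent j x (shade j 0F ∷ []) × Descent j x (shade j 2F ∷ shade j 1F ∷ [])
    ⊎ Descent j x (shade j 1F ∷ []) × Descent j x (shade j 2F ∷ shade j 0F ∷ [])

  widen : ∀ {j x k S} → Descent j x S → Descent j x (k ∷ S)
  widen (y , eq , route p u sub) = y , eq , route p u (there ∘ sub)

  palette : ℕ → List Colour
  palette zero    = []
  palette (suc j) = shade j 0F ∷ shade j 1F ∷ shade j 2F ∷ palette j

  module _ (i : Fin 3) where
    private j = toℕ i

    below : ∀ {x y} → lev x ≡ suc j → Parent x y → lev y ≡ j
    below eq (_ , p) = ℕ.suc-injective (trans (≡-sym p) eq)

    take-sel : ∀ {x a} → lev x ≡ suc j → sel x ≡ just a → Descent j x (shade j 0F ∷ [])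
    take-sel eq s = _ , below eq (sel-parent s) ,
      along (λ i → shade (toℕ i) 0F ∷ []) i (proj₁ (sel-parent s) by c-sel eq s ⇢ [])

    take-unsel : ∀ {x b} → lev x ≡ suc j → Parent x b → sel x ≢ just b → Descent j x (shade j 1F ∷ [])
    take-unsel eq p ¬s = _ , below eq p ,
      along (λ i → shade (toℕ i) 1F ∷ []) i (proj₁ p by c-unsel eq p ¬s ⇢ [])

    peer-sel : ∀ {x y} → lev x ≡ suc j → Peer x y → Descent j y (shade j 0F ∷ [])
             → Descent j x (shade j 2F ∷ shade j 0F ∷ [])
    peer-sel eq p (z , eq′ , r) = z , eq′ ,
      via (λ i → shade (toℕ i) 2F ∷ []) (λ i → shade (toℕ i) 0F ∷ [])
          (λ i → shade (toℕ i) 2F ∷ shade (toℕ i) 0F ∷ []) i (proj₁ p by c-peer eq p ⇢ []) r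

    peer-unsel : ∀ {x y} → lev x ≡ suc j → Peer x y → Descent j y (shade j 1F ∷ [])
               → Descent j x (shade j 2F ∷ shade j 1F ∷ [])
    peer-unsel eq p (z , eq′ , r) = z , eq′ ,
      via (λ i → shade (toℕ i) 2F ∷ []) (λ i → shade (toℕ i) 1F ∷ [])
          (λ i → shade (toℕ i) 2F ∷ shade (toℕ i) 1F ∷ []) i (proj₁ p by c-peer eq p ⇢ []) r

    not-root : ∀ {x} {A : Set} → lev x ≡ suc j → lev x ≡ 0 → A
    not-root eq eq′ = case trans (≡-sym eq) eq′ of λ ()

    -- The third vertex of a triangle on the edge to the parent `a` is adjacent to `a`, hence not
    -- above the level of `x`. Were it below, it would be a second parent.
    peer-exists : ∀ {x a} → Parent x a → ¬ Second x a → ∃ (Peer x)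
    peer-exists {x} {a} p@(e , eq) lone with triangle e
    ... | z , xz , az with lev x ℕ.≟ lev z
    ...   | yes peer = z , xz , peer
    ...   | no  ¬peer = contradiction (z , (xz , ≤-antisym (lev-edge xz) z<x) , z≢a) lone
      where
      z<x : lev z < lev x
      z<x = ℕ.≤∧≢⇒< (subst (lev z ≤_) (≡-sym eq) (lev-edge (E-sym az))) (¬peer ∘ ≡-sym)
      z≢a : z ≢ a
      z≢a refl = E-irrefl az

    -- A `low` vertex keeps its parent edge unchosen and borrows the chosen edge of a peer, all of
    -- its peers being `High`. A `high` vertex does the reverse: its peer `y` is not `High`, so it
    -- has an alternative to its choice or chose nothing, and either way descends by an unchosen
    -- edge.
    descents : ∀ x → lev x ≡ suc j → Descents j x
    descents x eq with sel x in s | status x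
    ... | nothing | free _ root = not-root eq root
    ... | just a  | both _ _ (b , p , b≢a) =
      inj₁ (take-sel eq s , widen (take-unsel eq p λ s′ → b≢a (just-injective (trans (≡-sym s′) s))))
    ... | nothing | low _ p lone peers with peer-exists p lone
    ...   | y , q with sel y in s′ | status y
    ...     | nothing | free ¬h _      = contradiction (peers y q) ¬h
    ...     | just _  | both ¬h _ _    = contradiction (peers y q) ¬h
    ...     | nothing | low ¬h _ _ _   = contradiction (peers y q) ¬h
    ...     | just _  | high _ _ _ _   =
      inj₂ ( take-unsel eq p (λ s″ → case trans (≡-sym s) s″ of λ ())
           , peer-sel eq q (take-sel (trans (≡-sym (proj₂ q)) eq) s′))
    descents x eq | just a | high _ _ _ (y , q , ¬h) = inj₁ (take-sel eq s , peer-unsel eq q unsel)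
      where
      eq′ : lev y ≡ suc j
      eq′ = trans (≡-sym (proj₂ q)) eq
      unsel : Descent j y (shade j 1F ∷ [])
      unsel with sel y in s′ | status y
      ... | nothing | free _ root           = not-root eq′ root
      ... | just _  | both _ _ (b , p , b≢) =
        take-unsel eq′ p λ s″ → b≢ (just-injective (trans (≡-sym s″) s′))
      ... | nothing | low _ p _ _           = take-unsel eq′ p λ s″ → case trans (≡-sym s′) s″ of λ ()
      ... | just _  | high h _ _ _          = contradiction h ¬h

    bridge : ∀ (S T : Fin 3 → List Colour)
             {_ : True (all? λ i → fits? (S i) (palette (toℕ i)) (S i ++ palette (toℕ i)))}
             {_ : True (all? λ i → fits? (S i ++ palette (toℕ i)) (T i) (palette (suc (toℕ i))))}
           → (∀ x y → lev x ≤ j → lev y ≤ j → Route x y (palette j))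
           → ∀ {x y} → Descent j x (S i) → Descent j y (T i) → Route x y (palette (suc j))
    bridge S T {f} {g} conn (_ , eq , r) (_ , eq′ , r′) =
      link (λ i → S i ++ palette (toℕ i)) T (λ i → palette (suc (toℕ i))) {g} i
        (link S (λ i → palette (toℕ i)) (λ i → S i ++ palette (toℕ i)) {f} i r
          (conn _ _ (≤-reflexive eq) (≤-reflexive eq′)))
        (reverseʳ r′)

    sel₀ unsel₀ sel₁ unsel₁ : Fin 3 → List Colour
    sel₀ i   = shade (toℕ i) 0F ∷ []
    unsel₀ i = shade (toℕ i) 1F ∷ []
    sel₁ i   = shade (toℕ i) 2F ∷ shade (toℕ i) 0F ∷ []
    unsel₁ i = shade (toℕ i) 2F ∷ shade (toℕ i) 1F ∷ []

    descend : ∀ (S : Fin 3 → List Colour)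
              {_ : True (all? λ i → fits? (S i) (palette (toℕ i)) (palette (suc (toℕ i))))}
            → (∀ x y → lev x ≤ j → lev y ≤ j → Route x y (palette j))
            → ∀ {x y} → Descent j x (S i) → lev y ≤ j → Route x y (palette (suc j))
    descend S {f} conn (_ , eq , r) y≤ =
      link S (λ i → palette (toℕ i)) (λ i → palette (suc (toℕ i))) {f} i r
        (conn _ _ (≤-reflexive eq) y≤)

    grow : (∀ x y → lev x ≤ j → lev y ≤ j → Route x y (palette j))
         → ∀ x y → lev x ≤ suc j → lev y ≤ suc j → Route x y (palette (suc j))
    grow conn x y x≤ y≤ with ℕ.m≤n⇒m<n∨m≡n x≤ | ℕ.m≤n⇒m<n∨m≡n y≤
    ... | inj₁ (s≤s x≤′) | inj₁ (s≤s y≤′) with conn x y x≤′ y≤′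
    ...   | route p u sub = route p u (there ∘ there ∘ there ∘ sub)
    grow conn x y x≤ y≤ | inj₂ x≡ | inj₂ y≡ with descents x x≡ | descents y y≡
    ... | inj₁ (p , _) | inj₁ (_ , q) = bridge sel₀ unsel₁ conn p q
    ... | inj₁ (p , _) | inj₂ (q , _) = bridge sel₀ unsel₀ conn p q
    ... | inj₂ (p , _) | inj₁ (q , _) = bridge unsel₀ sel₀ conn p q
    ... | inj₂ (p , _) | inj₂ (_ , q) = bridge unsel₀ sel₁ conn p q
    grow conn x y x≤ y≤ | inj₂ x≡ | inj₁ (s≤s y≤′) with descents x x≡
    ... | inj₁ (p , _) = descend sel₀ conn p y≤′
    ... | inj₂ (p , _) = descend unsel₀ conn p y≤′
    grow conn x y x≤ y≤ | inj₁ (s≤s x≤′) | inj₂ y≡ with descents y y≡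
    ... | inj₁ (p , _) = reverseʳ (descend sel₀ conn p x≤′)
    ... | inj₂ (p , _) = reverseʳ (descend unsel₀ conn p x≤′)

  rainbow : RainbowConn
  rainbow x y = palette 3 , conn₃ x y (lev≤3 x) (lev≤3 y)
    where
    at-root : ∀ {x} → lev x ≤ 0 → x ≡ root
    at-root {x} x≤ = subst (λ k → Within k x) (ℕ.n≤0⇒n≡0 x≤) (within-lev x)
    conn₀ : ∀ x y → lev x ≤ 0 → lev y ≤ 0 → Route x y []
    conn₀ x y x≤ y≤ rewrite at-root x≤ | at-root y≤ = stay
    conn₃ : ∀ x y → lev x ≤ 3 → lev y ≤ 3 → Route x y (palette 3)
    conn₃ = grow 2F (grow 1F (grow 0F conn₀))

-- An edge in no triangle: vertex classes, colours and route profiles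

Side : Set
Side = Fin 2

opp : Side → Side
opp 0F = 1F
opp 1F = 0F

opp-opp : ∀ s → opp (opp s) ≡ s
opp-opp 0F = refl
opp-opp 1F = refl

opp≢ : ∀ s → opp s ≢ s
opp≢ 0F ()
opp≢ 1F ()

≢⇒opp : ∀ {s t} → s ≢ t → t ≡ opp s
≢⇒opp {0F} {0F} ne = contradiction refl ne
≢⇒opp {0F} {1F} ne = refl
≢⇒opp {1F} {0F} ne = refl
≢⇒opp {1F} {1F} ne = contradiction refl ne

-- With uv an edge in no triangle, near s consists of the other neighbours of the hub of side s; a vertex at
-- distance at least 2 from both hubs is far s, mid or deep if it has neighbours in near s only, in both
-- near classes, or in neither.
data Class : Set where
  hubᶜ near far : Side → Class
  mid deep      : Class

_≟ᶜ_ : (k l : Class) → Dec (k ≡ l)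
k ≟ᶜ l = map′ (λ eq → trans (≡-sym (decode-code k)) (trans (cong decode eq) (decode-code l)))
              (cong code) (≡-dec ℕ._≟_ _≟_ (code k) (code l))
  where
  code : Class → ℕ × Side
  code (hubᶜ s) = 0 , s
  code (near s) = 1 , s
  code (far s)  = 2 , s
  code mid      = 3 , 0F
  code deep     = 4 , 0F
  decode : ℕ × Side → Class
  decode (0 , s) = hubᶜ s
  decode (1 , s) = near s
  decode (2 , s) = far s
  decode (3 , _) = mid
  decode _       = deep
  decode-code : ∀ k → decode (code k) ≡ k
  decode-code (hubᶜ s) = refl
  decode-code (near s) = refl
  decode-code (far s)  = refl
  decode-code mid      = refl
  decode-code deep     = refl

-- The content lies in the absent pairs. Hub `s` with `near (opp s)` is excluded because uv lies in
-- no triangle; `near s` with `far (opp s)` or `deep` because the latter have no neighbour in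
-- `near s`.
data Touching : Class → Class → Set where
  hub-hub   : ∀ {s t} → Touching (hubᶜ s) (hubᶜ t)
  hub-near  : ∀ {s} → Touching (hubᶜ s) (near s)
  near-hub  : ∀ {s} → Touching (near s) (hubᶜ s)
  near-near : ∀ {s t} → Touching (near s) (near t)
  near-far  : ∀ {s} → Touching (near s) (far s)
  far-near  : ∀ {s} → Touching (far s) (near s)
  near-mid  : ∀ {s} → Touching (near s) mid
  mid-near  : ∀ {s} → Touching mid (near s)
  far-far   : ∀ {s t} → Touching (far s) (far t)
  far-mid   : ∀ {s} → Touching (far s) mid
  mid-far   : ∀ {s} → Touching mid (far s)
  far-deep  : ∀ {s} → Touching (far s) deep
  deep-far  : ∀ {s} → Touching deep (far s)
  mid-mid   : Touching mid mid
  mid-deep  : Touching mid deep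
  deep-mid  : Touching deep mid
  deep-deep : Touching deep deep

hub-near-side : ∀ {s t} → Touching (hubᶜ s) (near t) → s ≡ t
hub-near-side hub-near = refl

far-near-side : ∀ {s t} → Touching (far s) (near t) → s ≡ t
far-near-side far-near = refl

k1 k2 k3 k4 : Side → Colour
k1 0F = # 0
k1 1F = # 1
k2 0F = # 2
k2 1F = # 3
k3 0F = # 4
k3 1F = # 5
k4 0F = # 6
k4 1F = # 7

γ : Colour
γ = # 8

-- Edges inside `near s` get `k2 (opp s)`, because a crossing route within `upSet s` may use one and
-- has to avoid `k1 s` and `k2 s`. Edges between the two sides get `k4 0F`, which belongs to
-- `upSet s` for both `s`.
nearTint farTint : Side → Side → Colour
nearTint s t = if does (s ≟ t) then k2 (opp s) else k4 0F
farTint  s t = if does (s ≟ t) then k3 s else k4 0F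

nearTint-sym : ∀ s t → nearTint s t ≡ nearTint t s
nearTint-sym 0F 0F = refl
nearTint-sym 0F 1F = refl
nearTint-sym 1F 0F = refl
nearTint-sym 1F 1F = refl

farTint-sym : ∀ s t → farTint s t ≡ farTint t s
farTint-sym 0F 0F = refl
farTint-sym 0F 1F = refl
farTint-sym 1F 0F = refl
farTint-sym 1F 1F = refl

nearTint-same : ∀ s → nearTint s s ≡ k2 (opp s)
nearTint-same 0F = refl
nearTint-same 1F = refl

nearTint-opp : ∀ s → nearTint s (opp s) ≡ k4 0F
nearTint-opp 0F = refl
nearTint-opp 1F = refl

farTint-same : ∀ s → farTint s s ≡ k3 s
farTint-same 0F = refl
farTint-same 1F = refl

farTint-opp : ∀ s → farTint s (opp s) ≡ k4 0F
farTint-opp 0F = refl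
farTint-opp 1F = refl

-- The flags of an edge x y say whether y chose x, and whether x chose y.
tint : Class → Class → Bool → Bool → Colour
tint (near s) (hubᶜ _) _ q = if q then k1 (opp s) else k1 s
tint (hubᶜ _) (near s) p _ = if p then k1 (opp s) else k1 s
tint (near s) (near t) _ _ = nearTint s t
tint (far s)  (near _) _ q = if q then k3 (opp s) else k2 s
tint (near _) (far s)  p _ = if p then k3 (opp s) else k2 s
tint (near s) mid      _ _ = k4 s
tint mid      (near s) _ _ = k4 s
tint (far s)  (far t)  _ _ = farTint s t
tint (far s)  mid      _ _ = k3 (opp s)
tint mid      (far s)  _ _ = k3 (opp s)
tint (far s)  deep     _ _ = k4 s
tint deep     (far s)  _ _ = k4 s
tint deep     mid      _ q = if q then k2 1F else k2 0F
tint mid      deep     p _ = if p then k2 1F else k2 0F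
tint deep     deep     _ _ = k3 1F
tint _        _        _ _ = γ

tint-sym : ∀ k l p q → tint k l p q ≡ tint l k q p
tint-sym (hubᶜ s) (hubᶜ t) p q = refl
tint-sym (hubᶜ s) (near t) p q = refl
tint-sym (hubᶜ s) (far t)  p q = refl
tint-sym (hubᶜ s) mid      p q = refl
tint-sym (hubᶜ s) deep     p q = refl
tint-sym (near s) (hubᶜ t) p q = refl
tint-sym (near s) (near t) p q = nearTint-sym s t
tint-sym (near s) (far t)  p q = refl
tint-sym (near s) mid      p q = refl
tint-sym (near s) deep     p q = refl
tint-sym (far s)  (hubᶜ t) p q = refl
tint-sym (far s)  (near t) p q = refl
tint-sym (far s)  (far t)  p q = farTint-sym s t
tint-sym (far s)  mid      p q = refl
tint-sym (far s)  deep     p q = refl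
tint-sym mid      (hubᶜ t) p q = refl
tint-sym mid      (near t) p q = refl
tint-sym mid      (far t)  p q = refl
tint-sym mid      mid      p q = refl
tint-sym mid      deep     p q = refl
tint-sym deep     (hubᶜ t) p q = refl
tint-sym deep     (near t) p q = refl
tint-sym deep     (far t)  p q = refl
tint-sym deep     mid      p q = refl
tint-sym deep     deep     p q = refl

-- Exits s and Crossing s concern the neighbours of a vertex of class near s; Enriching s those of a vertex of
-- class far s, through which it reaches the opposite hub without an edge to its own near class.
Exits Crossing Enriching : Side → Class → Set
Exits s (hubᶜ _) = ⊥
Exits s (near t) = s ≢ t
Exits s _        = ⊤
Crossing s (near t) = s ≢ t
Crossing s _        = ⊥
Enriching s (far t)  = s ≢ t
Enriching s mid      = ⊤
Enriching s deep     = ⊤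
Enriching s _        = ⊥

exits? : ∀ s k → Dec (Exits s k)
exits? s (hubᶜ _) = no λ ()
exits? s (near t) = ¬? (s ≟ t)
exits? s (far _)  = yes tt
exits? s mid      = yes tt
exits? s deep     = yes tt

crossing? : ∀ s k → Dec (Crossing s k)
crossing? s (hubᶜ _) = no λ ()
crossing? s (near t) = ¬? (s ≟ t)
crossing? s (far _)  = no λ ()
crossing? s mid      = no λ ()
crossing? s deep     = no λ ()

enriching? : ∀ s k → Dec (Enriching s k)
enriching? s (hubᶜ _) = no λ ()
enriching? s (near _) = no λ ()
enriching? s (far t)  = ¬? (s ≟ t)
enriching? s mid      = yes tt
enriching? s deep     = yes tt

-- The last four sets lead to the opposite hub, each adding the colour of one more initial edge to
-- the previous: `k3 (opp s)` for a chosen far-near edge, `k3 s` for a far-far edge, `k2 s` for an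
-- unchosen near-far edge. All omit `γ` and `k1 s`; up to `crossSet` they omit `k2 s`, up to
-- `detourSet` also `k3 s`. So each is disjoint from the home route of a vertex of the same kind and
-- side.
homeSet upSet detourSet crossSet nearSet : Side → List Colour
homeSet s   = k1 s ∷ k2 s ∷ k3 s ∷ k4 s ∷ []
upSet s     = k1 (opp s) ∷ k2 (opp s) ∷ k4 s ∷ k4 (opp s) ∷ []
detourSet s = k3 (opp s) ∷ upSet s
crossSet s  = k3 s ∷ detourSet s
nearSet s   = k2 s ∷ crossSet s

Option : Set
Option = Side × List Colour

Meet : Option → Option → Set
Meet (s , S) (t , T) = Disjoint S T × (s ≡ t ⊎ (γ ∉ S × γ ∉ T))

Compatible : List Option → List Option → Set
Compatible ps qs = Any (λ p → Any (Meet p) qs) ps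

meet? : ∀ p q → Dec (Meet p q)
meet? (s , S) (t , T) =
  disjoint? _≟_ S T ×-dec (s ≟ t ⊎-dec (¬? (_∈?_ _≟_ γ S) ×-dec ¬? (_∈?_ _≟_ γ T)))

compatible? : ∀ ps qs → Dec (Compatible ps qs)
compatible? ps qs = Any.any? (λ p → Any.any? (meet? p) qs) ps

pattern hub-kind        = 0F
pattern inner-low-kind  = 1F
pattern inner-high-kind = 2F
pattern outer-kind      = 3F
pattern far-kind        = 4F
pattern far-high-kind   = 5F
pattern mid-kind        = 6F
pattern deep-kind       = 7F
pattern deep-high-kind  = 8F

-- The third options of `far-high-kind` and `deep-high-kind` are made for each other: on side `1F`
-- any combination of their first two options shares a colour, while the third ones are disjoint and
-- end at different hubs.
options : Fin 9 → Side → List Option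
options hub-kind        s = (s , []) ∷ []
options inner-low-kind  s = (s , k1 s ∷ []) ∷ (s , k2 (opp s) ∷ k1 (opp s) ∷ []) ∷ []
options inner-high-kind s = (s , k1 (opp s) ∷ []) ∷ (s , k2 (opp s) ∷ k1 s ∷ []) ∷ []
options outer-kind      s = (s , k1 s ∷ []) ∷ (opp s , nearSet s) ∷ []
options far-kind        s = (s , k2 s ∷ k1 s ∷ []) ∷ (opp s , crossSet s) ∷ []
options far-high-kind   s = (s , k3 s ∷ k2 s ∷ k1 s ∷ []) ∷ (opp s , detourSet s)
                          ∷ (s , k3 (opp s) ∷ k1 s ∷ []) ∷ []
options mid-kind        _ = (0F , k4 0F ∷ k1 0F ∷ []) ∷ (1F , k4 1F ∷ k1 1F ∷ []) ∷ []
options deep-kind       _ = (0F , homeSet 0F) ∷ (1F , homeSet 1F) ∷ []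
options deep-high-kind  _ = (1F , k2 1F ∷ k4 1F ∷ k1 1F ∷ []) ∷ (0F , k3 1F ∷ homeSet 0F)
                          ∷ (0F , k2 1F ∷ k4 0F ∷ k1 0F ∷ []) ∷ []

-- The whole case distinction on pairs of vertices is this finite check.
opaque
  all-compatible : ∀ k l s t → Compatible (options k s) (options l t)
  all-compatible = from-yes (all? λ k → all? λ l → all? λ s → all? λ t →
                     compatible? (options k s) (options l t))

-- Classes of vertices around the edge uv and their adjacencies

module NoTriangle {n : ℕ} (H : FinGraph n) (bounds : Diam3MinDeg2 H) (u v : Fin n)
                  (uv : FinGraph.E H u v)
                  (noTriangle : ∀ z → ¬ (FinGraph.E H u z × FinGraph.E H v z)) where
  open FinGraph H
  open Diam3MinDeg2 bounds

  V : Set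
  V = Fin n

  hub : Side → V
  hub 0F = u
  hub 1F = v

  hub-edge : ∀ s → E (hub s) (hub (opp s))
  hub-edge 0F = uv
  hub-edge 1F = E-sym uv

  apart : ∀ s {z} → E (hub s) z → ¬ E (hub (opp s)) z
  apart 0F p q = noTriangle _ (p , q)
  apart 1F p q = noTriangle _ (q , p)

  Nearby : Side → V → Set
  Nearby s x = E (hub s) x × x ≢ hub (opp s)

  Touches : Side → V → Set
  Touches s x = ∃ λ a → Nearby s a × E x a

  touches? : ∀ s x → Dec (Touches s x)
  touches? s x = any? λ a → (E? (hub s) a ×-dec ¬? (a ≟ hub (opp s))) ×-dec E? x a

  Outside : V → Set
  Outside x = ∀ s → ¬ E (hub s) x

  data Is (x : V) : Class → Set where
    is-hub  : ∀ {s} → x ≡ hub s → Is x (hubᶜ s)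
    is-near : ∀ {s} → Nearby s x → Is x (near s)
    is-far  : ∀ {s} → Outside x → Touches s x → ¬ Touches (opp s) x → Is x (far s)
    is-mid  : Outside x → (∀ s → Touches s x) → Is x mid
    is-deep : Outside x → (∀ s → ¬ Touches s x) → Is x deep

  bySide : ∀ {P : Side → Set} → P 0F → P 1F → ∀ s → P s
  bySide p q 0F = p
  bySide p q 1F = q

  opaque
    classify : ∀ x → ∃ (Is x)
    classify x with x ≟ u | x ≟ v | E? u x | E? v x
    ... | yes eq | _      | _     | _     = hubᶜ 0F , is-hub eq
    ... | no _   | yes eq | _     | _     = hubᶜ 1F , is-hub eq
    ... | no _   | no x≢v | yes e | _     = near 0F , is-near (e , x≢v)
    ... | no x≢u | no _   | no _  | yes e = near 1F , is-near (e , x≢u)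
    ... | no _   | no _   | no ¬e | no ¬f with touches? 0F x | touches? 1F x
    ...   | yes p | yes q = mid    , is-mid  (bySide ¬e ¬f) (bySide p q)
    ...   | yes p | no ¬q = far 0F , is-far  (bySide ¬e ¬f) p ¬q
    ...   | no ¬p | yes q = far 1F , is-far  (bySide ¬e ¬f) q ¬p
    ...   | no ¬p | no ¬q = deep   , is-deep (bySide ¬e ¬f) (bySide ¬p ¬q)

  cls : V → Class
  cls x = proj₁ (classify x)

  is : ∀ {x k} → cls x ≡ k → Is x k
  is {x} refl = proj₂ (classify x)

  same-hub : ∀ {s t} {x} → E (hub s) x → E (hub t) x → s ≡ t
  same-hub {s} {t} p q with s ≟ t
  ... | yes eq = eq
  ... | no s≢t rewrite ≢⇒opp s≢t = contradiction q (apart s p)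

  Is-near : ∀ {s x k} → Nearby s x → Is x k → k ≡ near s
  Is-near {s} (e , x≢) (is-hub {t} refl) with s ≟ t
  ... | yes refl = contradiction e E-irrefl
  ... | no s≢t   = contradiction (cong hub (≢⇒opp s≢t)) x≢
  Is-near (e , _) (is-near (f , _)) = cong near (same-hub f e)
  Is-near {s} (e , _) (is-far o _ _)  = contradiction e (o s)
  Is-near {s} (e , _) (is-mid o _)    = contradiction e (o s)
  Is-near {s} (e , _) (is-deep o _)   = contradiction e (o s)

  near-cls : ∀ {s x} → Nearby s x → cls x ≡ near s
  near-cls {x = x} p = Is-near p (is refl)

  hub-cls : ∀ s → cls (hub s) ≡ hubᶜ s
  hub-cls s = only (is refl)
    where
    only : ∀ {k} → Is (hub s) k → k ≡ hubᶜ s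
    only (is-hub {t} eq) with s ≟ t
    ... | yes refl = refl
    ... | no s≢t rewrite ≢⇒opp s≢t = contradiction (subst (E (hub s)) (≡-sym eq) (hub-edge s)) E-irrefl
    only (is-near {t} (e , x≢)) with s ≟ t
    ... | yes refl = contradiction e E-irrefl
    ... | no s≢t rewrite ≢⇒opp s≢t = contradiction (cong hub (≡-sym (opp-opp s))) x≢
    only (is-far o _ _) = contradiction (E-sym (hub-edge s)) (o (opp s))
    only (is-mid o _)  = contradiction (E-sym (hub-edge s)) (o (opp s))
    only (is-deep o _) = contradiction (E-sym (hub-edge s)) (o (opp s))

  hub-touching : ∀ {s x k} → E (hub s) x → Is x k → Touching (hubᶜ s) k
  hub-touching e (is-hub _)    = hub-hub
  hub-touching e (is-near (f , _)) with same-hub e f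
  ... | refl = hub-near
  hub-touching {s} e (is-far o _ _)  = contradiction e (o s)
  hub-touching {s} e (is-mid o _)    = contradiction e (o s)
  hub-touching {s} e (is-deep o _)   = contradiction e (o s)

  Touching-sym : ∀ {k l} → Touching k l → Touching l k
  Touching-sym hub-hub   = hub-hub
  Touching-sym hub-near  = near-hub
  Touching-sym near-hub  = hub-near
  Touching-sym near-near = near-near
  Touching-sym near-far  = far-near
  Touching-sym far-near  = near-far
  Touching-sym near-mid  = mid-near
  Touching-sym mid-near  = near-mid
  Touching-sym far-far   = far-far
  Touching-sym far-mid   = mid-far
  Touching-sym mid-far   = far-mid
  Touching-sym far-deep  = deep-far
  Touching-sym deep-far  = far-deep
  Touching-sym mid-mid   = mid-mid
  Touching-sym mid-deep  = deep-mid
  Touching-sym deep-mid  = mid-deep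
  Touching-sym deep-deep = deep-deep

  near-touching : ∀ {s x y k} → Nearby s x → E x y → Is y k → Touching (near s) k
  near-touching p e (is-hub refl) = Touching-sym (hub-touching (E-sym e) (is-near p))
  near-touching p e (is-near _)   = near-near
  near-touching {s} p e (is-far {t} _ _ ¬t) with s ≟ t
  ... | yes refl = near-far
  ... | no s≢t   = contradiction (subst (λ s → Touches s _) (≢⇒opp (s≢t ∘ ≡-sym)) (_ , p , E-sym e)) ¬t
  near-touching p e (is-mid _ _)   = near-mid
  near-touching {s} p e (is-deep _ ¬t) = contradiction (_ , p , E-sym e) (¬t s)

  touching : ∀ {x y k l} → E x y → Is x k → Is y l → Touching k l
  touching e (is-hub refl)  q             = hub-touching e q
  touching e (is-near p)    q             = near-touching p e q
  touching e p              (is-hub refl) = Touching-sym (hub-touching (E-sym e) p)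
  touching e p              (is-near q)   = Touching-sym (near-touching q (E-sym e) p)
  touching e (is-far _ _ _) (is-far _ _ _) = far-far
  touching e (is-far _ _ _) (is-mid _ _)   = far-mid
  touching e (is-far _ _ _) (is-deep _ _)  = far-deep
  touching e (is-mid _ _)   (is-far _ _ _) = mid-far
  touching e (is-mid _ _)   (is-mid _ _)   = mid-mid
  touching e (is-mid _ _)   (is-deep _ _)  = mid-deep
  touching e (is-deep _ _)  (is-far _ _ _) = deep-far
  touching e (is-deep _ _)  (is-mid _ _)   = deep-mid
  touching e (is-deep _ _)  (is-deep _ _)  = deep-deep

  meets : ∀ {x y k} → cls x ≡ k → E x y → Touching k (cls y)
  meets p e = touching e (is p) (is refl)

  near-edge : ∀ {s x} → cls x ≡ near s → E x (hub s)
  near-edge p with is p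
  ... | is-near (e , _) = E-sym e

  -- Which vertices are offered an edge to choose

  Neighbour : (Class → Set) → V → Set
  Neighbour P x = ∃ λ y → E x y × P (cls y)

  neighbour? : ∀ {P} → (∀ k → Dec (P k)) → ∀ x → Dec (Neighbour P x)
  neighbour? P? x = any? λ y → E? x y ×-dec P? (cls y)

  Outer Crosses Rich : Side → V → Set
  Outer   = Neighbour ∘ Exits
  Crosses = Neighbour ∘ Crossing
  Rich    = Neighbour ∘ Enriching

  -- These are the shapes in which at most two edges can lead from `near s` to `near (opp s)`;
  -- `near-up` shows that no other shape occurs.
  Up : Side → V → Set
  Up s a = Crosses s a ⊎ Neighbour (_≡ mid) a ⊎ ∃ λ b → (E a b × cls b ≡ near s) × Crosses s b

  up? : ∀ s a → Dec (Up s a)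
  up? s a = neighbour? (crossing? s) a ⊎-dec neighbour? (_≟ᶜ mid) a
    ⊎-dec any? λ b → (E? a b ×-dec (cls b ≟ᶜ near s)) ×-dec neighbour? (crossing? s) b

  Step : Class → V → V → Set
  Step k x y = E x y × cls y ≡ k

  step? : ∀ k x y → Dec (Step k x y)
  step? k x y = E? x y ×-dec (cls y ≟ᶜ k)

  UpNear : Side → V → V → Set
  UpNear s x a = Step (near s) x a × Up s a

  -- An edge is offered only where the exceptional colour is wanted: in `near s` to a vertex
  -- confined to its hub and `near s`, in `far s` to one that can cross only by descending to
  -- `near s` first, in `deep` to one that reaches v only through `mid`. The sides differ for
  -- `deep`: a neighbour in `far 1F` frees the vertex, one in `far 0F` is an alternative.
  FreeAt : Class → V → Set
  FreeAt (hubᶜ _) x = ⊤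
  FreeAt (near s) x = Outer s x
  FreeAt (far s)  x = Rich s x ⊎ ¬ ∃ (UpNear s x)
  FreeAt mid      x = ⊤
  FreeAt deep     x = Neighbour (_≡ far 1F) x

  CandAt : Class → V → V → Set
  CandAt (hubᶜ _) x a = ⊥
  CandAt (near s) x a = ¬ Outer s x × a ≡ hub s
  CandAt (far s)  x a = ¬ Rich s x × UpNear s x a
  CandAt mid      x a = ⊥
  CandAt deep     x a = ¬ Neighbour (_≡ far 1F) x × Step mid x a

  Another : Class → V → V → Set
  Another k x a = ∃ λ b → Step k x b × b ≢ a

  another? : ∀ k x a → Dec (Another k x a)
  another? k x a = any? λ b → step? k x b ×-dec ¬? (b ≟ a)

  -- A chosen edge no longer carries the colour of the home route (for `deep`, of the route to u);
  -- an alternative replaces it there.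
  AltAt : Class → V → V → Set
  AltAt (hubᶜ _) x a = ⊥
  AltAt (near s) x a = ⊥
  AltAt (far s)  x a = Another (near s) x a
  AltAt mid      x a = ⊥
  AltAt deep     x a = Neighbour (_≡ far 0F) x ⊎ Another mid x a

  altAt? : ∀ k x a → Dec (AltAt k x a)
  altAt? (hubᶜ _) x a = no λ ()
  altAt? (near s) x a = no λ ()
  altAt? (far s)  x a = another? (near s) x a
  altAt? mid      x a = no λ ()
  altAt? deep     x a = neighbour? (_≟ᶜ far 0F) x ⊎-dec another? mid x a

  to-near : ∀ {s x} → Touches s x → ∃ (Step (near s) x)
  to-near (a , p , e) = a , e , near-cls p

  far-down : ∀ {s x} → cls x ≡ far s → ∃ (Step (near s) x)
  far-down p with is p
  ... | is-far _ t _ = to-near t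

  mid-down : ∀ {x} → cls x ≡ mid → ∀ s → ∃ (Step (near s) x)
  mid-down p s with is p
  ... | is-mid _ t = to-near (t s)

  -- On a path of at most three steps to `hub s` the last vertex before the end is a hub or in
  -- `near s`. Nothing in `deep` touches these, so the first step must leave `deep`; if it enters a
  -- far class, the next step shows that its side is `s`.
  deep-down : ∀ {x} → cls x ≡ deep → ∀ s → Neighbour (_≡ far s) x ⊎ Neighbour (_≡ mid) x
  deep-down {x} p s with diam x (hub s)
  ... | a , b , xa , ab , bh = first xa
    where
    data AtHub : Class → Set where
      at-hub  : ∀ {t} → AtHub (hubᶜ t)
      at-near : AtHub (near s)
    last : b ⁼ hub s → AtHub (cls b)
    last (inj₁ refl) rewrite hub-cls s = at-hub
    last (inj₂ e) with cls b | touching {k = cls b} e (is refl) (is (hub-cls s))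
    ... | _ | hub-hub  = at-hub
    ... | _ | near-hub = at-near
    far-only : ∀ {t k} → Touching (far t) k → AtHub k → t ≡ s
    far-only far-near at-near = refl
    deep-not : ∀ {k} → Touching deep k → ¬ AtHub k
    deep-not deep-far ()
    deep-not deep-mid ()
    deep-not deep-deep ()
    from-deep : ∀ {a} → cls a ≡ deep → a ⁼ b → ⊥
    from-deep q (inj₁ refl) = case subst AtHub q (last bh) of λ ()
    from-deep q (inj₂ e)    = deep-not (meets q e) (last bh)
    from-far : ∀ {t} → cls a ≡ far t → a ⁼ b → t ≡ s
    from-far q (inj₁ refl) = case subst AtHub q (last bh) of λ ()
    from-far q (inj₂ e)    = far-only (meets q e) (last bh)
    first : x ⁼ a → Neighbour (_≡ far s) x ⊎ Neighbour (_≡ mid) x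
    first (inj₁ refl) = ⊥-elim (from-deep p ab)
    first (inj₂ e) with cls a in q | meets p e
    ... | _ | deep-far  = inj₁ (a , e , trans q (cong far (from-far q ab)))
    ... | _ | deep-mid  = inj₂ (a , e , q)
    ... | _ | deep-deep = ⊥-elim (from-deep q ab)

  pickAt : ∀ k x → cls x ≡ k → FreeAt k x ⊎ ∃ (CandAt k x)
  pickAt (hubᶜ s) x _ = inj₁ tt
  pickAt mid      x _ = inj₁ tt
  pickAt (near s) x _ with neighbour? (exits? s) x
  ... | yes o = inj₁ o
  ... | no ¬o = inj₂ (hub s , ¬o , refl)
  pickAt (far s) x _ with neighbour? (enriching? s) x | any? (λ a → step? (near s) x a ×-dec up? s a)
  ... | yes r | _           = inj₁ (inj₁ r)
  ... | no _  | no ¬u       = inj₁ (inj₂ ¬u)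
  ... | no ¬r | yes (a , w) = inj₂ (a , ¬r , w)
  pickAt deep x p with neighbour? (_≟ᶜ far 1F) x
  ... | yes f = inj₁ f
  ... | no ¬f with deep-down p 1F
  ...   | inj₁ f       = contradiction f ¬f
  ...   | inj₂ (i , w) = inj₂ (i , ¬f , w)

  Peer : V → V → Set
  Peer x y = E x y × cls x ≡ cls y

  opaque
    chosen : Selection Peer (λ x → FreeAt (cls x) x) (λ x → CandAt (cls x) x) (λ x → AltAt (cls x) x)
    chosen = selection (λ x → pickAt (cls x) x refl) (λ x → altAt? (cls x) x)
      where open Labelling Peer (λ x y → E? x y ×-dec (cls x ≟ᶜ cls y))
                           (λ (e , eq) → E-sym e , ≡-sym eq) (E-irrefl ∘ proj₁) using (selection)

  open Selection chosen

  status-at : ∀ {k x} → cls x ≡ k → Status Peer (FreeAt k) (CandAt k) (AltAt k) High x (sel x)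
  status-at {x = x} refl with sel x | status x
  ... | _ | free ¬h f      = free ¬h f
  ... | _ | both ¬h c a    = both ¬h c a
  ... | _ | low ¬h c ¬a ps = low ¬h c ¬a ps
  ... | _ | high h c ¬a p  = high h c ¬a p

  -- The colouring and the routes it provides

  chose : V → V → Bool
  chose x y = does (Maybe.≡-dec _≟_ (sel x) (just y))

  opaque
    c : V → V → Colour
    c x y = tint (cls x) (cls y) (chose y x) (chose x y)

    c-sym : ∀ x y → c x y ≡ c y x
    c-sym x y = tint-sym (cls x) (cls y) _ _

    c-plain : ∀ {x y k l} → cls x ≡ k → cls y ≡ l → c x y ≡ tint k l (chose y x) (chose x y)
    c-plain refl refl = refl

  c-sel : ∀ {x y k l} → cls x ≡ k → cls y ≡ l → sel x ≡ just y → c x y ≡ tint k l (chose y x) true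
  c-sel {x} {y} {k} {l} p q s =
    trans (c-plain p q) (cong (tint k l (chose y x)) (dec-true (Maybe.≡-dec _≟_ (sel x) (just y)) s))

  c-unsel : ∀ {x y k l} → cls x ≡ k → cls y ≡ l → sel x ≢ just y → c x y ≡ tint k l (chose y x) false
  c-unsel {x} {y} {k} {l} p q s =
    trans (c-plain p q) (cong (tint k l (chose y x)) (dec-false (Maybe.≡-dec _≟_ (sel x) (just y)) s))

  open Routes H c c-sym

  unchosen : ∀ {x a} → sel x ≡ nothing → sel x ≢ just a
  unchosen s s′ = case trans (≡-sym s) s′ of λ ()

  not-other : ∀ {x a b} → sel x ≡ just a → b ≢ a → sel x ≢ just b
  not-other s b≢a s′ = b≢a (just-injective (trans (≡-sym s′) s))

  -- A route entering `near s` from outside arrives at a vertex with an exit, namely the way back.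
  -- Such a vertex is offered no edge, so its hub edge has the ordinary colour.
  hub-trail : ∀ {s a} → cls a ≡ near s → Outer s a → Trail a (hub s) (k1 s ∷ [])
  hub-trail {s} {a} p o = near-edge p by c-unsel p (hub-cls s) not-chosen ⇢ []
    where
    not-chosen : sel a ≢ just (hub s)
    not-chosen with sel a | status-at p
    ... | _ | free _ _              = λ ()
    ... | _ | low _ (¬o , _) _ _    = contradiction o ¬o
    ... | _ | high _ (¬o , _) _ _   = contradiction o ¬o

  crossing-step : ∀ {s a} → cls a ≡ near s → Crosses s a → Trail a (hub (opp s)) (k4 0F ∷ k1 (opp s) ∷ [])
  crossing-step {s} p (b , e , cr) with cls b in q
  ... | near t with ≢⇒opp cr
  ...   | refl = e by trans (c-plain p q) (nearTint-opp s)
      ⇢ hub-trail q (_ , E-sym e , subst (Exits (opp s)) (≡-sym p) (opp≢ s))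

  rich⇒¬high : ∀ {s x} → cls x ≡ far s → Rich s x → ¬ High x
  rich⇒¬high {x = x} p r with sel x | status-at p
  ... | _ | free ¬h _           = ¬h
  ... | _ | both ¬h _ _         = ¬h
  ... | _ | low ¬h _ _ _        = ¬h
  ... | _ | high _ (¬r , _) _ _ = contradiction r ¬r

  far-trail : ∀ {s x a} → cls x ≡ far s → Step (near s) x a → sel x ≢ just a
            → Trail x (hub s) (k2 s ∷ k1 s ∷ [])
  far-trail {s} p (e , q) ¬s =
    e by c-unsel p q ¬s ⇢ hub-trail q (_ , E-sym e , subst (Exits s) (≡-sym p) tt)

  far-home : ∀ {s x} → cls x ≡ far s → ¬ High x → Trail x (hub s) (k2 s ∷ k1 s ∷ [])
  far-home {s} {x} p ¬h with sel x in eq | status-at p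
  ... | _ | free _ _              = far-trail p (proj₂ (far-down p)) (unchosen eq)
  ... | _ | both _ _ (b , w , b≢) = far-trail p w (not-other eq b≢)
  ... | _ | low _ (_ , w , _) _ _ = far-trail p w (unchosen eq)
  ... | _ | high h _ _ _          = contradiction h ¬h

  mid-trail : ∀ {x} → cls x ≡ mid → ∀ s → Trail x (hub s) (k4 s ∷ k1 s ∷ [])
  mid-trail p s with mid-down p s
  ... | a , e , q = e by c-plain p q ⇢ hub-trail q (_ , E-sym e , subst (Exits s) (≡-sym p) tt)

  deep-far-trail : ∀ {s x} → cls x ≡ deep → Neighbour (_≡ far s) x → Trail x (hub s) (k4 s ∷ k2 s ∷ k1 s ∷ [])
  deep-far-trail {s} p (d , e , q) = e by c-plain p q ⇢
    far-home q (rich⇒¬high q (_ , E-sym e , subst (Enriching s) (≡-sym p) tt))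

  deep-unsel-trail : ∀ {x i} → cls x ≡ deep → Step mid x i → sel x ≢ just i
                   → ∀ s → Trail x (hub s) (k2 0F ∷ k4 s ∷ k1 s ∷ [])
  deep-unsel-trail p (e , q) ¬s s = e by c-unsel p q ¬s ⇢ mid-trail q s

  deep-sel-trail : ∀ {x i} → cls x ≡ deep → Step mid x i → sel x ≡ just i
                 → ∀ s → Trail x (hub s) (k2 1F ∷ k4 s ∷ k1 s ∷ [])
  deep-sel-trail p (e , q) s′ s = e by c-sel p q s′ ⇢ mid-trail q s

  within : ∀ {m} (ks T : Fin m → List Colour) {_ : True (all? λ i → unique? _≟_ (ks i))}
           {_ : True (all? λ i → fits? (ks i) [] (T i))} → ∀ i {x y} → Trail x y (ks i) → Route x y (T i)
  within ks T {u} {ok} i p = via ks (λ _ → []) T {u} {ok} i p stay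

  deep-left : ∀ {x} → cls x ≡ deep → ¬ High x → Route x (hub 0F) (homeSet 0F)
  deep-left {x} p ¬h = go
    where
    through-far : Neighbour (_≡ far 0F) x → Route x (hub 0F) (homeSet 0F)
    through-far w = within (λ s → k4 s ∷ k2 s ∷ k1 s ∷ []) homeSet 0F (deep-far-trail p w)
    through-mid : ∀ {i} → Step mid x i → sel x ≢ just i → Route x (hub 0F) (homeSet 0F)
    through-mid w ¬s = within {1} (λ _ → k2 0F ∷ k4 0F ∷ k1 0F ∷ []) (λ _ → homeSet 0F) 0F
                         (deep-unsel-trail p w ¬s 0F)
    go : Route x (hub 0F) (homeSet 0F)
    go with sel x in eq | status-at p
    ... | _ | both _ _ (inj₁ w)            = through-far w
    ... | _ | both _ _ (inj₂ (b , w , b≢)) = through-mid w (not-other eq b≢)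
    ... | _ | low _ (_ , w) _ _            = through-mid w (unchosen eq)
    ... | _ | high h _ _ _                 = contradiction h ¬h
    ... | _ | free _ _ with deep-down p 0F
    ...   | inj₁ w       = through-far w
    ...   | inj₂ (i , w) = through-mid w (unchosen eq)

  high-trail : ∀ {x} → cls x ≡ deep → High x → ∀ s → Trail x (hub s) (k2 1F ∷ k4 s ∷ k1 s ∷ [])
  high-trail {x} p h with sel x in eq | status-at p
  ... | _ | free ¬h _          = contradiction h ¬h
  ... | _ | both ¬h _ _        = contradiction h ¬h
  ... | _ | low ¬h _ _ _       = contradiction h ¬h
  ... | _ | high _ (_ , w) _ _ = deep-sel-trail p w eq

  deep-peer : ∀ {x i} → cls x ≡ deep → CandAt deep x i → ¬ AltAt deep x i → ∃ (Peer x)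
  deep-peer {x} {i} p (¬f , _) ¬alt with deg x i
  ... | z , e , z≢i with cls z in q | meets p e
  ...   | _ | deep-far {0F} = contradiction (inj₁ (z , e , q)) ¬alt
  ...   | _ | deep-far {1F} = contradiction (z , e , q) ¬f
  ...   | _ | deep-mid      = contradiction (inj₂ (z , (e , q) , z≢i)) ¬alt
  ...   | _ | deep-deep     = z , e , trans p (≡-sym q)

  deep-right : ∀ {x} → cls x ≡ deep → Route x (hub 1F) (homeSet 1F)
  deep-right {x} p with sel x in eq | status-at p
  ... | _ | free _ w          = within (λ s → k4 s ∷ k2 s ∷ k1 s ∷ []) homeSet 1F (deep-far-trail p w)
  ... | _ | both _ (_ , w) _  = within {1} (λ _ → k2 1F ∷ k4 1F ∷ k1 1F ∷ []) (λ _ → homeSet 1F) 0F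
                                  (deep-sel-trail p w eq 1F)
  ... | _ | high _ (_ , w) _ _ = within {1} (λ _ → k2 1F ∷ k4 1F ∷ k1 1F ∷ []) (λ _ → homeSet 1F) 0F
                                  (deep-sel-trail p w eq 1F)
  ... | _ | low _ cand ¬alt peers with deep-peer p cand ¬alt
  ...   | y , e , q = within {1} (λ _ → k3 1F ∷ k2 1F ∷ k4 1F ∷ k1 1F ∷ []) (λ _ → homeSet 1F) 0F
                        (e by c-plain p p′ ⇢ high-trail p′ (peers y (e , q)) 1F)
    where
    p′ : cls y ≡ deep
    p′ = trans (≡-sym q) p

  -- The deep-deep edge costs `k3 1F`. That fits into `homeSet 1F` when a `low` vertex goes to v,
  -- but has to be added on the way to u; `High` vertices make up for it by a route to v that omits
  -- `k3 1F`.
  deep-high-left : ∀ {x} → cls x ≡ deep → High x → Route x (hub 0F) (k3 1F ∷ homeSet 0F)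
  deep-high-left {x} p h with sel x | status-at p
  ... | _ | free ¬h _    = contradiction h ¬h
  ... | _ | both ¬h _ _  = contradiction h ¬h
  ... | _ | low ¬h _ _ _ = contradiction h ¬h
  ... | _ | high _ _ _ (y , (e , q) , ¬h) =
    via {1} (λ _ → k3 1F ∷ []) (λ _ → homeSet 0F) (λ _ → k3 1F ∷ homeSet 0F) 0F
      (e by c-plain p p′ ⇢ []) (deep-left p′ ¬h)
    where
    p′ : cls y ≡ deep
    p′ = trans (≡-sym q) p

  up-route : ∀ {s a} → cls a ≡ near s → Up s a → Route a (hub (opp s)) (upSet s)
  up-route {s} p (inj₁ w) = within (λ s → k4 0F ∷ k1 (opp s) ∷ []) upSet s (crossing-step p w)
  up-route {s} p (inj₂ (inj₁ (i , e , q))) =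
    within (λ s → k4 s ∷ k4 (opp s) ∷ k1 (opp s) ∷ []) upSet s (e by c-plain p q ⇢ mid-trail q (opp s))
  up-route {s} p (inj₂ (inj₂ (b , (e , q) , w))) =
    within (λ s → k2 (opp s) ∷ k4 0F ∷ k1 (opp s) ∷ []) upSet s
      (e by trans (c-plain p q) (nearTint-same s) ⇢ crossing-step q w)

  far-deep⇒¬high : ∀ {x} → cls x ≡ deep → Neighbour (_≡ far 1F) x → ¬ High x
  far-deep⇒¬high {x} p w with sel x | status-at p
  ... | _ | free ¬h _           = ¬h
  ... | _ | both ¬h _ _         = ¬h
  ... | _ | low ¬h _ _ _        = ¬h
  ... | _ | high _ (¬f , _) _ _ = contradiction w ¬f

  rich-detour : ∀ {s x} → cls x ≡ far s → Rich s x → Route x (hub (opp s)) (detourSet s)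
  rich-detour {s} {x} p (y , e , r) with cls y in q
  ... | mid = within (λ s → k3 (opp s) ∷ k4 (opp s) ∷ k1 (opp s) ∷ []) detourSet s
                (e by c-plain p q ⇢ mid-trail q (opp s))
  ... | far t with ≢⇒opp r
  ...   | refl = within (λ s → k4 0F ∷ k2 (opp s) ∷ k1 (opp s) ∷ []) detourSet s
                   (e by trans (c-plain p q) (farTint-opp s) ⇢ far-home q (rich⇒¬high q
                     (_ , E-sym e , subst (Enriching (opp s)) (≡-sym p) (opp≢ s))))
  rich-detour {s} {x} p (y , e , r) | deep =
    via (λ s → k4 s ∷ []) (homeSet ∘ opp) detourSet s (e by c-plain p q ⇢ []) (home s p)
    where
    -- Every deep vertex has a home route to v. The one to u requires that `y` is not `High`, which
    -- its neighbour `x` in `far 1F` ensures.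
    home : ∀ s → cls x ≡ far s → Route y (hub (opp s)) (homeSet (opp s))
    home 0F _ = deep-right q
    home 1F p = deep-left q (far-deep⇒¬high q (x , E-sym e , p))

  sel-detour : ∀ {s x a} → cls x ≡ far s → UpNear s x a → sel x ≡ just a → Route x (hub (opp s)) (detourSet s)
  sel-detour {s} p ((e , q) , up) s′ =
    via (λ s → k3 (opp s) ∷ []) upSet detourSet s (e by c-sel p q s′ ⇢ []) (up-route q up)

  high-detour : ∀ {s x} → cls x ≡ far s → High x → Route x (hub (opp s)) (detourSet s)
  high-detour {x = x} p h with sel x in eq | status-at p
  ... | _ | free ¬h _            = contradiction h ¬h
  ... | _ | both ¬h _ _          = contradiction h ¬h
  ... | _ | low ¬h _ _ _         = contradiction h ¬h
  ... | _ | high _ (_ , un) _ _  = sel-detour p un eq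

  -- Crossing to the opposite hub without the edge uv

  module Partner {s} {b₀ : V} (b₀-near : cls b₀ ≡ near (opp s)) where

    Opposite : V → Set
    Opposite q = cls q ≡ near (opp s) ⊎ ∃ λ b → E q b × cls b ≡ near (opp s)

    opposite : ∀ {q} → q ⁼ b₀ → Opposite q
    opposite (inj₁ refl) = inj₁ b₀-near
    opposite (inj₂ e)    = inj₂ (b₀ , e , b₀-near)

    crossing : ∀ {k} → k ≡ near (opp s) → Crossing s k
    crossing refl = opp≢ s ∘ ≡-sym

    far-no : ∀ {x} → cls x ≡ far s → ¬ Opposite x
    far-no p (inj₁ q) = case trans (≡-sym p) q of λ ()
    far-no p (inj₂ (b , e , q)) = opp≢ s (≡-sym (far-near-side (subst (Touching (far s)) q (meets p e))))

    near-up : ∀ {p q} → cls p ≡ near s → p ⁼ q → Opposite q → Up s p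
    near-up cp (inj₁ refl) (inj₁ cq) = contradiction refl (crossing (trans (≡-sym cp) cq))
    near-up cp (inj₁ refl) (inj₂ (b , e , cb)) = inj₁ (b , e , crossing cb)
    near-up cp (inj₂ e) (inj₁ cq) = inj₁ (_ , e , crossing cq)
    near-up {q = q} cp (inj₂ e) (inj₂ (b , f , cb)) with cls q in cq | meets cp e
    -- A path through the hub of side `s` would go on to a vertex of `near (opp s)`, which would
    -- form a triangle with uv.
    ... | _ | near-hub = contradiction (≡-sym (hub-near-side (subst (Touching _) cb (meets cq f)))) (opp≢ s)
    ... | _ | near-mid = inj₂ (inj₁ (q , e , cq))
    ... | _ | near-far = contradiction (inj₂ (b , f , cb)) (far-no cq)
    ... | _ | near-near {t = t} with s ≟ t
    ...   | yes refl = inj₂ (inj₂ (q , (e , cq) , b , f , crossing cb))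
    ...   | no s≢t   = inj₁ (q , e , subst (Crossing s) (≡-sym cq) s≢t)

    far-up : ∀ {p q} → cls p ≡ far s → p ⁼ q → Opposite q → Rich s p ⊎ ∃ (UpNear s p)
    far-up cp (inj₁ refl) o = contradiction o (far-no cp)
    far-up cp (inj₂ e) (inj₁ cq) = contradiction (inj₂ (_ , e , cq)) (far-no cp)
    far-up {q = q} cp (inj₂ e) (inj₂ (b , f , cb)) with cls q in cq | meets cp e
    ... | _ | far-near = inj₂ (q , (e , cq) , inj₁ (b , f , crossing cb))
    ... | _ | far-mid  = inj₁ (q , e , subst (Enriching s) (≡-sym cq) tt)
    ... | _ | far-deep = inj₁ (q , e , subst (Enriching s) (≡-sym cq) tt)
    ... | _ | far-far {t = t} with s ≟ t
    ...   | yes refl = contradiction (inj₂ (b , f , cb)) (far-no cq)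
    ...   | no s≢t   = inj₁ (q , e , subst (Enriching s) (≡-sym cq) s≢t)

    -- When `x` itself has no way across, the path from `x` to `b₀` must begin inside `far s`, and
    -- its two remaining steps give a way across to the vertex `y` reached first.
    partner : ∀ {x} → cls x ≡ far s → ¬ Rich s x → ¬ ∃ (UpNear s x)
            → ∃ λ y → Peer x y × (Rich s y ⊎ ∃ (UpNear s y))
    partner {x} p ¬r ¬u with diam x b₀
    ... | a , b , inj₁ refl , ab , bb = contradiction (far-up p ab (opposite bb)) [ ¬r , ¬u ]′
    ... | a , b , inj₂ e , ab , bb with cls a in q | meets p e
    ...   | _ | far-near = contradiction (a , (e , q) , near-up q ab (opposite bb)) ¬u
    ...   | _ | far-mid  = contradiction (a , e , subst (Enriching s) (≡-sym q) tt) ¬r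
    ...   | _ | far-deep = contradiction (a , e , subst (Enriching s) (≡-sym q) tt) ¬r
    ...   | _ | far-far {t = t} with s ≟ t
    ...     | yes refl = a , (e , trans p (≡-sym q)) , far-up q ab (opposite bb)
    ...     | no s≢t   = contradiction (a , e , subst (Enriching s) (≡-sym q) s≢t) ¬r

  near-exists : ∀ s → ∃ λ b → cls b ≡ near s
  near-exists s with deg (hub s) (hub (opp s))
  ... | b , e , b≢ = b , near-cls (e , b≢)

  far-peer : ∀ {s x a} → cls x ≡ far s → ¬ Rich s x → ¬ Another (near s) x a → ∃ (Peer x)
  far-peer {s} {x} {a} p ¬r ¬alt with deg x a
  ... | z , e , z≢a with cls z in q | meets p e
  ...   | _ | far-near = contradiction (z , (e , q) , z≢a) ¬alt
  ...   | _ | far-mid  = contradiction (z , e , subst (Enriching s) (≡-sym q) tt) ¬r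
  ...   | _ | far-deep = contradiction (z , e , subst (Enriching s) (≡-sym q) tt) ¬r
  ...   | _ | far-far {t = t} with s ≟ t
  ...     | yes refl = z , e , trans p (≡-sym q)
  ...     | no s≢t   = contradiction (z , e , subst (Enriching s) (≡-sym q) s≢t) ¬r

  peer-detour : ∀ {s x y} → cls x ≡ far s → Peer x y → Route y (hub (opp s)) (detourSet s)
              → Route x (hub (opp s)) (crossSet s)
  peer-detour {s} p (e , q) r =
    via (λ s → k3 s ∷ []) detourSet crossSet s
      (e by trans (c-plain p (trans (≡-sym q) p)) (farTint-same s) ⇢ []) r

  weaken : ∀ {k x y S} → Route x y S → Route x y (k ∷ S)
  weaken (route p u sub) = route p u (there ∘ sub)

  far-cross : ∀ {s x} → cls x ≡ far s → Route x (hub (opp s)) (crossSet s)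
  far-cross {s} {x} p with sel x in eq | status-at p
  ... | _ | both _ (_ , un) _             = weaken (sel-detour p un eq)
  ... | _ | high _ (_ , un) _ _           = weaken (sel-detour p un eq)
  ... | _ | free _ (inj₁ r)               = weaken (rich-detour p r)
  ... | _ | low _ (¬r , _) ¬alt peers with far-peer p ¬r ¬alt
  ...   | y , e , q = peer-detour p (e , q) (high-detour (trans (≡-sym q) p) (peers y (e , q)))
  far-cross {s} {x} p | _ | free ¬h (inj₂ ¬u) with neighbour? (enriching? s) x
  ... | yes r = weaken (rich-detour p r)
  ... | no ¬r with Partner.partner (proj₂ (near-exists (opp s))) p ¬r ¬u
  ...   | y , (e , q) , good = peer-detour p (e , q) (detour good)
    where
    p′ : cls y ≡ far s
    p′ = trans (≡-sym q) p
    detour : Rich s y ⊎ ∃ (UpNear s y) → Route y (hub (opp s)) (detourSet s)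
    detour (inj₁ r) = rich-detour p′ r
    detour (inj₂ u) with sel y in eq | status-at p′
    ... | _ | both _ (_ , un) _      = sel-detour p′ un eq
    ... | _ | high _ (_ , un) _ _    = sel-detour p′ un eq
    ... | _ | free _ (inj₁ r)        = rich-detour p′ r
    ... | _ | free _ (inj₂ ¬u)       = contradiction u ¬u
    -- If `y` were low, its peer `x` would be `High`, but `x` is free.
    ... | _ | low _ _ _ peers        = contradiction (peers x (E-sym e , ≡-sym q)) ¬h

  near-cross : ∀ {s a} → cls a ≡ near s → Outer s a → Route a (hub (opp s)) (nearSet s)
  near-cross {s} {a} p (y , e , o) with up? s a
  ... | yes up = weaken (weaken (weaken (up-route p up)))
  ... | no ¬up with cls y in q | meets p e
  ...   | _ | near-near = contradiction (inj₁ (y , e , subst (Crossing s) (≡-sym q) o)) ¬up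
  ...   | _ | near-mid  = contradiction (inj₂ (inj₁ (y , e , q))) ¬up
  ...   | _ | near-far  =
    via (λ s → k2 s ∷ []) crossSet nearSet s (e by c-flag ⇢ []) (far-cross q)
    where
    -- Far vertices choose only vertices satisfying `Up`, and `a` does not, so the edge keeps
    -- `k2 s`.
    not-chosen : sel y ≢ just a
    not-chosen with sel y | status-at q
    ... | _ | free _ _                       = λ ()
    ... | _ | both _ (_ , _ , up) _          = λ { refl → ¬up up }
    ... | _ | low _ _ _ _                    = λ ()
    ... | _ | high _ (_ , _ , up) _ _        = λ { refl → ¬up up }
    c-flag : c a y ≡ k2 s
    c-flag = trans (c-sym a y) (c-unsel q p not-chosen)

  -- By minimum degree 2 there is a neighbour besides the hub; without exits it can only lie in
  -- `near s`.
  inner-peer : ∀ {s a} → cls a ≡ near s → ¬ Outer s a → ∃ (Peer a)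
  inner-peer {s} {a} p ¬o with deg a (hub s)
  ... | z , e , z≢ with cls z in q | meets p e
  ...   | _ | near-hub = contradiction (hub-of (is q)) z≢
    where
    hub-of : Is z (hubᶜ s) → z ≡ hub s
    hub-of (is-hub eq) = eq
  ...   | _ | near-mid = contradiction (z , e , subst (Exits s) (≡-sym q) tt) ¬o
  ...   | _ | near-far = contradiction (z , e , subst (Exits s) (≡-sym q) tt) ¬o
  ...   | _ | near-near {t = t} with s ≟ t
  ...     | yes refl = z , e , trans p (≡-sym q)
  ...     | no s≢t   = contradiction (z , e , subst (Exits s) (≡-sym q) s≢t) ¬o

  peer-trail : ∀ {s a b ks} → cls a ≡ near s → Peer a b → Trail b (hub s) ks → Trail a (hub s) (k2 (opp s) ∷ ks)
  peer-trail {s} p (e , q) r = e by trans (c-plain p (trans (≡-sym q) p)) (nearTint-same s) ⇢ r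

  sel-hub-trail : ∀ {s a} → cls a ≡ near s → sel a ≡ just (hub s) → Trail a (hub s) (k1 (opp s) ∷ [])
  sel-hub-trail {s} p s′ = near-edge p by c-sel p (hub-cls s) s′ ⇢ []

  unsel-hub-trail : ∀ {s a} → cls a ≡ near s → sel a ≡ nothing → Trail a (hub s) (k1 s ∷ [])
  unsel-hub-trail {s} p eq = near-edge p by c-unsel p (hub-cls s) (unchosen eq) ⇢ []

  inner-high-trail : ∀ {s a} → cls a ≡ near s → High a → Trail a (hub s) (k1 (opp s) ∷ [])
  inner-high-trail {a = a} p h with sel a in eq | status-at p
  ... | _ | free ¬h _                = contradiction h ¬h
  ... | _ | low ¬h _ _ _             = contradiction h ¬h
  ... | _ | high _ (_ , refl) _ _    = sel-hub-trail p eq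

  inner-low-trail : ∀ {s a} → cls a ≡ near s → ¬ High a → Trail a (hub s) (k1 s ∷ [])
  inner-low-trail {a = a} p ¬h with sel a in eq | status-at p
  ... | _ | free _ _     = unsel-hub-trail p eq
  ... | _ | low _ _ _ _  = unsel-hub-trail p eq
  ... | _ | high h _ _ _ = contradiction h ¬h

  far-high-option : ∀ {s x a} → cls x ≡ far s → UpNear s x a → sel x ≡ just a
                  → Trail x (hub s) (k3 (opp s) ∷ k1 s ∷ [])
  far-high-option {s} p ((e , q) , _) s′ =
    e by c-sel p q s′ ⇢ hub-trail q (_ , E-sym e , subst (Exits s) (≡-sym p) tt)

  -- Route profiles of all vertices and their combination

  Reaches : V → Option → Set
  Reaches x (s , S) = Route x (hub s) S

  Profile : V → Set
  Profile x = ∃₂ λ k s → All (Reaches x) (options k s)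

  profile-at : ∀ x k → Is x k → cls x ≡ k → Profile x
  profile-at x (hubᶜ s) (is-hub refl) p = hub-kind , s , stay ∷ []
  profile-at x (near s) _ p with sel x in eq | status-at p
  ... | _ | free _ o = outer-kind , s , along (λ s → k1 s ∷ []) s (hub-trail p o) ∷ near-cross p o ∷ []
  ... | _ | low _ (¬o , _) _ peers with inner-peer p ¬o
  ...   | y , e , q = inner-low-kind , s
          , along (λ s → k1 s ∷ []) s (unsel-hub-trail p eq)
          ∷ along (λ s → k2 (opp s) ∷ k1 (opp s) ∷ []) s
              (peer-trail p (e , q) (inner-high-trail (trans (≡-sym q) p) (peers y (e , q))))
          ∷ []
  profile-at x (near s) _ p | _ | high _ (_ , refl) _ (y , (e , q) , ¬h) = inner-high-kind , s
    , along (λ s → k1 (opp s) ∷ []) s (sel-hub-trail p eq)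
    ∷ along (λ s → k2 (opp s) ∷ k1 s ∷ []) s
        (peer-trail p (e , q) (inner-low-trail (trans (≡-sym q) p) ¬h))
    ∷ []
  profile-at x (far s) _ p with sel x in eq | status-at p
  ... | _ | free ¬h _    = far-kind , s , along (λ s → k2 s ∷ k1 s ∷ []) s (far-home p ¬h) ∷ far-cross p ∷ []
  ... | _ | both ¬h _ _  = far-kind , s , along (λ s → k2 s ∷ k1 s ∷ []) s (far-home p ¬h) ∷ far-cross p ∷ []
  ... | _ | low ¬h _ _ _ = far-kind , s , along (λ s → k2 s ∷ k1 s ∷ []) s (far-home p ¬h) ∷ far-cross p ∷ []
  ... | _ | high h (_ , un) _ (y , (e , q) , ¬h) = far-high-kind , s
    , along (λ s → k3 s ∷ k2 s ∷ k1 s ∷ []) s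
        (e by trans (c-plain p p′) (farTint-same s) ⇢ far-home p′ ¬h)
    ∷ sel-detour p un eq
    ∷ along (λ s → k3 (opp s) ∷ k1 s ∷ []) s (far-high-option p un eq)
    ∷ []
    where
    p′ : cls y ≡ far s
    p′ = trans (≡-sym q) p
  profile-at x mid _ p = mid-kind , 0F , reach 0F ∷ reach 1F ∷ []
    where
    reach : ∀ s → Route x (hub s) (k4 s ∷ k1 s ∷ [])
    reach s = along (λ s → k4 s ∷ k1 s ∷ []) s (mid-trail p s)
  profile-at x deep _ p with sel x | status-at p
  ... | _ | free ¬h _    = deep-kind , 0F , deep-left p ¬h ∷ deep-right p ∷ []
  ... | _ | both ¬h _ _  = deep-kind , 0F , deep-left p ¬h ∷ deep-right p ∷ []
  ... | _ | low ¬h _ _ _ = deep-kind , 0F , deep-left p ¬h ∷ deep-right p ∷ []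
  ... | _ | high h _ _ _ = deep-high-kind , 0F , reach 1F ∷ deep-high-left p h ∷ reach 0F ∷ []
    where
    reach : ∀ s → Route x (hub s) (k2 1F ∷ k4 s ∷ k1 s ∷ [])
    reach s = along (λ s → k2 1F ∷ k4 s ∷ k1 s ∷ []) s (high-trail p h s)

  hub-trail-across : ∀ s → Trail (hub s) (hub (opp s)) (γ ∷ [])
  hub-trail-across s = hub-edge s by c-plain (hub-cls s) (hub-cls (opp s)) ⇢ []

  connect : ∀ {x y p q} → Reaches x p → Reaches y q → Meet p q → ∃ (Route x y)
  connect {p = s , S} {q = t , T} r r′ (dis , same) with s ≟ t
  ... | yes refl = S ++ T , join (dis , ∈-++⁺ˡ , ∈-++⁺ʳ S) r (reverseʳ r′)
  ... | no s≢t with ≢⇒opp s≢t | same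
  ...   | _    | inj₁ s≡t         = contradiction s≡t s≢t
  ...   | refl | inj₂ (γ∉S , γ∉T) = S ++ γ ∷ T ,
    join (dis′ , ∈-++⁺ˡ , ∈-++⁺ʳ S) r
      (join (γ-fresh , (λ { (here eq) → here eq }) , there) across (reverseʳ r′))
    where
    across : Route (hub s) (hub (opp s)) (γ ∷ [])
    across = along {1} (λ _ → γ ∷ []) 0F (hub-trail-across s)
    γ-fresh : Disjoint (γ ∷ []) T
    γ-fresh (here refl , γ∈T) = γ∉T γ∈T
    dis′ : Disjoint S (γ ∷ T)
    dis′ (k∈S , here refl) = γ∉S k∈S
    dis′ (k∈S , there k∈T) = dis (k∈S , k∈T)

  meeting : ∀ {x y ps qs} → All (Reaches x) ps → All (Reaches y) qs → Compatible ps qs → ∃ (Route x y)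
  meeting rs rs′ i with All.lookupAny rs i
  ... | r , j with All.lookupAny rs′ j
  ...   | r′ , m = connect r r′ m

  rainbow : RainbowConn
  rainbow x y with profile-at x (cls x) (is refl) refl | profile-at y (cls y) (is refl) refl
  ... | k , s , rs | l , t , rs′ = meeting rs rs′ (all-compatible k l s t)

-- The case distinction

theorem4 : ∀ (n : ℕ) (G : Graph n) → Bridgeless G → HasDiam G 3 → RcLe G 9
theorem4 n G bridgeless hasDiam =
  -- Triangles are sought in `H` rather than in `G`: there the search is decidable, and both
  -- colourings argue with edges of `H` alone.
  case any? (λ u → any? λ v → E? u v ×-dec all? λ z → ¬? (E? u z ×-dec E? v z)) of λ where
    (yes (u , v , uv , noTriangle)) →
      let open NoTriangle H bounds u v uv noTriangle
      in Shortcut.rainbow⇒RcLe G H c c-sym Used⇒Adj rainbow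
    (no none) →
      let open Triangles H (Diam3MinDeg2.diam bounds) (triangle none) (proj₁ distinct)
      in Shortcut.rainbow⇒RcLe G H c c-sym Used⇒Adj rainbow
  where
  open Extract G bridgeless hasDiam
  open FinGraph H
  triangle : ¬ (∃₂ λ u v → E u v × ∀ z → ¬ (E u z × E v z)) → ∀ {u v} → E u v → ∃ λ z → E u z × E v z
  triangle none {u} {v} e with any? (λ z → E? u z ×-dec E? v z)
  ... | yes t = t
  ... | no ¬t = contradiction (u , v , e , λ z t → ¬t (z , t)) none
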